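{- Let $(W,S)$ be a finite irreducible Coxeter system, let $\mathcal{P}$ be a parameter tensor for $(W,S)$, and let $v\in\mathcal{R}(w_\circ)$ be a reduced word of the longest element $w_\circ$, with abelian vector $\alpha_v$. The determinant of the model matrix $M(v,\mathcal{P})$ of $v$ with respect to $\mathcal{P}$ is the multivariate polynomial \[ \det M(v,\mathcal{P})=\sigma(v)\;\mathcal{V}(v)\sum_{\mathfrak{z}\in\mathfrak{Z}_{\alpha_v}}\det[\mathcal{P}]_{\mathfrak{z}}\;\mathsf{S}_{\Lambda_{\mathfrak{z}},\Omega_v}, \] where $\Lambda_{\mathfrak{z}}=(\lambda^{\mathfrak{z},1},\dots,\lambda^{\mathfrak{z},n})$ is the sequence of standard partitions of $\mathfrak{z}$, $\Omega_v=(\{v\}_1,\dots,\{v\}_n)$, and $\mathsf{S}_{\Lambda_{\mathfrak{z}},\Omega_v}$ is the partial Schur function with respect to $\Lambda_{\mathfrak{z}}$ and $\Omega_v$.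
   Context: Setting. $(W,S)$ is a finite irreducible Coxeter system with $S=\{s_1<\dots<s_n\}$, $w_\circ$ is its longest element, $N$ is the length of $w_\circ$, $\mathcal{R}(w_\circ)$ is the set of reduced words of $w_\circ$ (words of length $N$ in $S$ representing $w_\circ$), and $\nu$ is the maximum number of occurrences of a letter in any word of $\mathcal{R}(w_\circ)$. Words. For $v=v_1\cdots v_N$, let $\{v\}_i:=\{j\in[N]:v_j=s_i\}$ and $c_i:=\#\{v\}_i$; the abelian vector is $\alpha_v=(c_1,\dots,c_n)$. The $S$-sign is $\sigma(v)=(-1)^{\operatorname{inv}(v)}$, where $\operatorname{inv}(v)$ is the number of pairs $a<b$ with $v_b<v_a$. The Vandermonde divisor of $v$ is \[\mathcal{V}(v):=\prod_{s_i\in S,\ c_i\ge 2}\ \prod_{v_j=v_k=s_i,\ j<k}(x_k-x_j).\] Parameter tensor and model matrix. A parameter tensor for $(W,S)$ is a real array $\mathcal{P}=(p^i{}_{s,k})$ with $(i,s,k)\in[N]\times S\times\{0,\dots,\nu-1\}$, regarded as an $N\times n\nu$ matrix with rows indexed by $i$ and columns indexed by pairs $(s,k)$ in lexicographic order. The model matrix $M(v,\mathcal{P})$ is the $N\times N$ matrix over $\mathbb{R}[x_1,\dots,x_N]$ whose $(i,l)$ entry is $\sum_{k=0}^{\nu-1}p^i{}_{v_l,k}\,x_l^{k}$. Minors. $\mathfrak{Z}_{\alpha_v}$ is the collection of subsets $\mathfrak{z}\subseteq S\times\{0,\dots,\nu-1\}$ containing exactly $c_i$ elements with first coordinate $s_i$,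 for every $i\in[n]$. $[\mathcal{P}]_{\mathfrak{z}}$ is the $N\times N$ submatrix of $\mathcal{P}$ with columns $\mathfrak{z}$ in increasing lexicographic order. For $\mathfrak{z}\in\mathfrak{Z}_{\alpha_v}$ and $i\in[n]$, the standard partition $\lambda^{\mathfrak{z},i}$ is obtained by listing the second coordinates of the elements of $\mathfrak{z}$ with first coordinate $s_i$ in decreasing order and subtracting $c_i-j$ from the entry at position $j$, $j=1,\dots,c_i$. Schur functions. For a partition $\lambda=(\lambda_1\ge\dots\ge\lambda_d\ge0)$ and an ordered index set $J$ with $\#J=d$, \[\mathsf{s}_{\lambda,J}:=\frac{\det\big(x_j^{\,i-1+\lambda_{d-i+1}}\big)_{(i,j)\in[d]\times J}}{\det\big(x_j^{\,i-1}\big)_{(i,j)\in[d]\times J}}.\] For an ordered set partition $P=(p_1,\dots,p_n)$ of $[N]$ (empty parts allowed) and a sequence $\Lambda=(\lambda^1,\dots,\lambda^n)$ of partitions where $\lambda^i$ has $\#p_i$ parts (parts may be zero), the partial Schur function is $\mathsf{S}_{\Lambda,P}:=\prod_{i=1}^n\mathsf{s}_{\lambda^i,p_i}$. -}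

module Defs where

open import Algebra.Bundles using (CommutativeRing; Group)
open import Data.Bool.Base using (Bool; true; if_then_else_)
open import Data.Fin.Base as Fin using (Fin; zero; suc; toℕ; fromℕ<; inject₁; punchIn; punchOut)
import Data.Fin.Properties as Finₚ
open import Data.List.Base as List using (List; []; _∷_; _++_)
import Data.List.Properties as Listₚ
import Data.Maybe.Base as Maybe
open import Data.Nat.Base as Nat using (ℕ; zero; suc)
import Data.Nat.Properties as ℕₚ
open import Data.Product using (∃; ∃!; _×_; _,_; proj₁; proj₂; uncurry)
open import Data.Rational.Base as Rat using (ℚ; 0ℚ; 1ℚ; ½)
import Data.Rational.Properties as ℚₚ
open import Data.Vec.Base as Vec using (Vec; []; _∷_)
import Data.Vec.Properties as Vecₚ
open import Function.Base using (_∘_)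
open import Function.Bundles using (Inverse)
open import Level using (0ℓ; _⊔_) renaming (suc to lsuc)
open import Relation.Binary.Construct.Closure.Equivalence using (EqClosure)
open import Relation.Binary.Construct.Closure.ReflexiveTransitive using (Star)
open import Relation.Binary.PropositionalEquality as ≡ using (_≡_; _≢_)
open import Relation.Nullary.Decidable
  using (Dec; yes; no; does; dec-true; dec-false; dec⇒maybe; _×-dec_)
open import Relation.Nullary.Negation using (contradiction)

module RingLemmas {c ℓ} (R : CommutativeRing c ℓ) where

  open CommutativeRing R hiding (zero)
  open import Algebra.Properties.Ring ring
    using (-‿distribʳ-*; -‿+-comm; -‿involutive; x[y-z]≈xy-xz)
  open import Relation.Binary.Reasoning.Setoid setoid
  open import Algebra.Properties.CommutativeSemigroup +-commutativeSemigroup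
    using (interchange)

  neg-sub : ∀ a b → - (a - b) ≈ b - a
  neg-sub a b = begin
    - (a - b)      ≈⟨ -‿+-comm a (- b) ⟨
    - a + - - b    ≈⟨ +-congˡ (-‿involutive b) ⟩
    - a + b        ≈⟨ +-comm _ _ ⟩
    b - a          ∎

  telescope : ∀ a b c → (a - b) + (b - c) ≈ a - c
  telescope a b c = begin
    (a - b) + (b - c)      ≈⟨ +-assoc _ _ _ ⟩
    a + (- b + (b - c))    ≈⟨ +-congˡ (+-assoc _ _ _) ⟨
    a + ((- b + b) - c)    ≈⟨ +-congˡ (+-congʳ (-‿inverseˡ b)) ⟩
    a + (0# - c)           ≈⟨ +-congˡ (+-identityˡ _) ⟩
    a - c                  ∎

  sub-+ : ∀ a b c d → (a - b) + (c - d) ≈ (a + c) - (b + d)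
  sub-+ a b c d = trans (interchange a (- b) c (- d)) (+-congˡ (-‿+-comm b d))

  sub-* : ∀ a b c d → a * (c - d) + d * (a - b) ≈ a * c - b * d
  sub-* a b c d = begin
    a * (c - d) + d * (a - b)            ≈⟨ +-cong (x[y-z]≈xy-xz a c d) (x[y-z]≈xy-xz d a b) ⟩
    (a * c - a * d) + (d * a - d * b)    ≈⟨ +-congˡ (+-cong (*-comm d a) (-‿cong (*-comm d b))) ⟩
    (a * c - a * d) + (a * d - b * d)    ≈⟨ telescope _ _ _ ⟩
    a * c - b * d                        ∎

module ℚ-lemmas = RingLemmas ℚₚ.+-*-commutativeRing

module Reals where

  open Rat using (_+_; _*_; _-_; -_; ∣_∣; _<_; _≤_)

  Cauchy : (ℕ → ℚ) → Set
  Cauchy x = ∀ ε → 0ℚ < ε →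
    ∃ λ K → ∀ m n → K Nat.≤ m → K Nat.≤ n → ∣ x m - x n ∣ < ε

  Null : (ℕ → ℚ) → Set
  Null d = ∀ ε → 0ℚ < ε → ∃ λ K → ∀ n → K Nat.≤ n → ∣ d n ∣ < ε

  -- Real numbers are Cauchy sequences of rationals, up to null differences.
  record Real : Set where
    constructor real
    field
      seq    : ℕ → ℚ
      cauchy : Cauchy seq
  open Real

  _≈ʳ_ : Real → Real → Set
  x ≈ʳ y = Null (λ n → seq x n - seq y n)

  private
    half+half : ∀ ε → ½ * ε + ½ * ε ≡ ε
    half+half ε = ≡.trans (≡.sym (ℚₚ.*-distribʳ-+ ε ½ ½)) (ℚₚ.*-identityˡ ε)

    half-pos : ∀ {ε} → 0ℚ < ε → 0ℚ < ½ * ε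
    half-pos {ε} 0<ε = ≡.subst (_< ½ * ε) (ℚₚ.*-zeroʳ ½) (ℚₚ.*-monoʳ-<-pos ½ 0<ε)

    +-small : ∀ {ε} p q → ∣ p ∣ < ½ * ε → ∣ q ∣ < ½ * ε → ∣ p + q ∣ < ε
    +-small {ε} p q p< q< = ≡.subst (∣ p + q ∣ <_) (half+half ε)
      (ℚₚ.≤-<-trans (ℚₚ.∣p+q∣≤∣p∣+∣q∣ p q) (ℚₚ.+-mono-< p< q<))

    scale : ∀ b → 0ℚ < b → ∀ ε → 0ℚ < ε →
            ∃ λ δ → 0ℚ < δ × (∀ p q → ∣ p ∣ ≤ b → ∣ q ∣ < δ → ∣ p * q ∣ < ε)
    scale b 0<b ε 0<ε = δ , 0<δ , small
      where
      instance
        b-pos : Rat.Positive b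
        b-pos = Rat.positive 0<b
        b-nonZero : Rat.NonZero b
        b-nonZero = ℚₚ.pos⇒nonZero b
        b⁻¹-pos : Rat.Positive (Rat.1/ b)
        b⁻¹-pos = ℚₚ.1/pos⇒pos b
      δ : ℚ
      δ = Rat.1/ b * ε
      0<δ : 0ℚ < δ
      0<δ = ≡.subst (_< δ) (ℚₚ.*-zeroʳ (Rat.1/ b)) (ℚₚ.*-monoʳ-<-pos (Rat.1/ b) 0<ε)
      bδ≡ε : b * δ ≡ ε
      bδ≡ε = ≡.trans (≡.sym (ℚₚ.*-assoc b (Rat.1/ b) ε))
               (≡.trans (≡.cong (_* ε) (ℚₚ.*-inverseʳ b)) (ℚₚ.*-identityˡ ε))
      small : ∀ p q → ∣ p ∣ ≤ b → ∣ q ∣ < δ → ∣ p * q ∣ < ε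
      small p q p≤b q<δ = ≡.subst₂ _<_ (≡.sym (ℚₚ.∣p*q∣≡∣p∣*∣q∣ p q)) bδ≡ε
        (ℚₚ.≤-<-trans
          (ℚₚ.*-monoʳ-≤-nonNeg ∣ q ∣ {{ℚₚ.∣-∣-nonNeg q}} p≤b)
          (ℚₚ.*-monoʳ-<-pos b q<δ))

    bounded : ∀ x → Cauchy x →
              ∃ λ b → 0ℚ < b × ∃ λ K → ∀ n → K Nat.≤ n → ∣ x n ∣ ≤ b
    bounded x cx with cx 1ℚ (ℚₚ.positive⁻¹ 1ℚ)
    ... | K , c = b , 0<b , K , λ n K≤n → ℚₚ.<⇒≤ (below n K≤n)
      where
      b : ℚ
      b = ∣ x K ∣ + 1ℚ
      0<b : 0ℚ < b
      0<b = ≡.subst (_< b) (ℚₚ.+-identityˡ 0ℚ)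
              (ℚₚ.+-mono-≤-< (ℚₚ.0≤∣p∣ (x K)) (ℚₚ.positive⁻¹ 1ℚ))
      split : ∀ p q → p ≡ q + (p - q)
      split p q = ≡.sym (≡.trans (ℚₚ.+-comm q (p - q))
        (≡.trans (ℚₚ.+-assoc p (- q) q)
          (≡.trans (≡.cong (p +_) (ℚₚ.+-inverseˡ q)) (ℚₚ.+-identityʳ p))))
      below : ∀ n → K Nat.≤ n → ∣ x n ∣ < b
      below n K≤n = ≡.subst (λ p → ∣ p ∣ < b) (≡.sym (split (x n) (x K)))
        (ℚₚ.≤-<-trans (ℚₚ.∣p+q∣≤∣p∣+∣q∣ (x K) (x n - x K))
          (ℚₚ.+-monoʳ-< ∣ x K ∣ (c n K K≤n ℕₚ.≤-refl)))

    null-≗ : ∀ {c d} → (∀ n → c n ≡ d n) → Null c → Null d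
    null-≗ c≡d nc ε 0<ε with nc ε 0<ε
    ... | K , c< = K , λ n K≤n → ≡.subst (λ p → ∣ p ∣ < ε) (c≡d n) (c< n K≤n)

    null-0 : ∀ {d} → (∀ n → d n ≡ 0ℚ) → Null d
    null-0 d≡0 ε 0<ε = 0 , λ n _ → ≡.subst (λ p → ∣ p ∣ < ε) (≡.sym (d≡0 n)) 0<ε

    null-+ : ∀ {c d} → Null c → Null d → Null (λ n → c n + d n)
    null-+ {c} {d} nc nd ε 0<ε with nc (½ * ε) (half-pos 0<ε) | nd (½ * ε) (half-pos 0<ε)
    ... | K , c< | L , d< = K Nat.⊔ L , λ n le →
      +-small (c n) (d n) (c< n (ℕₚ.m⊔n≤o⇒m≤o K L le)) (d< n (ℕₚ.m⊔n≤o⇒n≤o K L le))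

    null-neg : ∀ {c} → Null c → Null (λ n → - c n)
    null-neg {c} nc ε 0<ε with nc ε 0<ε
    ... | K , c< = K , λ n le → ≡.subst (_< ε) (≡.sym (ℚₚ.∣-p∣≡∣p∣ (c n))) (c< n le)

    null-* : ∀ {x d} → Cauchy x → Null d → Null (λ n → x n * d n)
    null-* {x} {d} cx nd ε 0<ε with bounded x cx
    ... | b , 0<b , K , x≤b with scale b 0<b ε 0<ε
    ... | δ , 0<δ , small with nd δ 0<δ
    ... | L , d< = K Nat.⊔ L , λ n le →
      small (x n) (d n) (x≤b n (ℕₚ.m⊔n≤o⇒m≤o K L le)) (d< n (ℕₚ.m⊔n≤o⇒n≤o K L le))

    cauchy-const : ∀ p → Cauchy (λ _ → p)
    cauchy-const p ε 0<ε = 0 , λ _ _ _ _ →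
      ≡.subst (λ q → ∣ q ∣ < ε) (≡.sym (ℚₚ.+-inverseʳ p)) 0<ε

    cauchy-+ : ∀ {x y} → Cauchy x → Cauchy y → Cauchy (λ n → x n + y n)
    cauchy-+ {x} {y} cx cy ε 0<ε with cx (½ * ε) (half-pos 0<ε) | cy (½ * ε) (half-pos 0<ε)
    ... | K , x< | L , y< = K Nat.⊔ L , λ m n lm ln →
      ≡.subst (λ p → ∣ p ∣ < ε) (ℚ-lemmas.sub-+ (x m) (x n) (y m) (y n))
        (+-small (x m - x n) (y m - y n)
          (x< m n (ℕₚ.m⊔n≤o⇒m≤o K L lm) (ℕₚ.m⊔n≤o⇒m≤o K L ln))
          (y< m n (ℕₚ.m⊔n≤o⇒n≤o K L lm) (ℕₚ.m⊔n≤o⇒n≤o K L ln)))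

    cauchy-neg : ∀ {x} → Cauchy x → Cauchy (λ n → - x n)
    cauchy-neg {x} cx ε 0<ε with cx ε 0<ε
    ... | K , x< = K , λ m n lm ln →
      ≡.subst (_< ε) (≡.trans (≡.sym (ℚₚ.∣-p∣≡∣p∣ (x m - x n))) (≡.cong ∣_∣ (ℚₚ.neg-distrib-+ (x m) (- x n)))) (x< m n lm ln)

    cauchy-* : ∀ {x y} → Cauchy x → Cauchy y → Cauchy (λ n → x n * y n)
    cauchy-* {x} {y} cx cy ε 0<ε with bounded x cx | bounded y cy
    ... | a , 0<a , K₁ , x≤a | b , 0<b , K₂ , y≤b
      with scale a 0<a (½ * ε) (half-pos 0<ε) | scale b 0<b (½ * ε) (half-pos 0<ε)
    ... | δ , 0<δ , smallx | η , 0<η , smally with cy δ 0<δ | cx η 0<η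
    ... | K₃ , y< | K₄ , x< = (K₁ Nat.⊔ K₂) Nat.⊔ (K₃ Nat.⊔ K₄) , λ m n lm ln →
      let lm₁ = ℕₚ.m⊔n≤o⇒m≤o (K₁ Nat.⊔ K₂) (K₃ Nat.⊔ K₄) lm
          lm₂ = ℕₚ.m⊔n≤o⇒n≤o (K₁ Nat.⊔ K₂) (K₃ Nat.⊔ K₄) lm
          ln₁ = ℕₚ.m⊔n≤o⇒m≤o (K₁ Nat.⊔ K₂) (K₃ Nat.⊔ K₄) ln
          ln₂ = ℕₚ.m⊔n≤o⇒n≤o (K₁ Nat.⊔ K₂) (K₃ Nat.⊔ K₄) ln
      in ≡.subst (λ p → ∣ p ∣ < ε) (ℚ-lemmas.sub-* (x m) (x n) (y m) (y n))
        (+-small (x m * (y m - y n)) (y n * (x m - x n))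
          (smallx (x m) (y m - y n) (x≤a m (ℕₚ.m⊔n≤o⇒m≤o K₁ K₂ lm₁))
            (y< m n (ℕₚ.m⊔n≤o⇒m≤o K₃ K₄ lm₂) (ℕₚ.m⊔n≤o⇒m≤o K₃ K₄ ln₂)))
          (smally (y n) (x m - x n) (y≤b n (ℕₚ.m⊔n≤o⇒n≤o K₁ K₂ ln₁))
            (x< m n (ℕₚ.m⊔n≤o⇒n≤o K₃ K₄ lm₂) (ℕₚ.m⊔n≤o⇒n≤o K₃ K₄ ln₂))))

    pointwise : ∀ {x y} → (∀ n → seq x n ≡ seq y n) → x ≈ʳ y
    pointwise {x} {y} x≡y = null-0 λ n →
      ≡.trans (≡.cong (_- seq y n) (x≡y n)) (ℚₚ.+-inverseʳ (seq y n))

  _+ʳ_ : Real → Real → Real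
  x +ʳ y = real (λ n → seq x n + seq y n) (cauchy-+ {seq x} {seq y} (cauchy x) (cauchy y))

  _*ʳ_ : Real → Real → Real
  x *ʳ y = real (λ n → seq x n * seq y n) (cauchy-* {seq x} {seq y} (cauchy x) (cauchy y))

  -ʳ_ : Real → Real
  -ʳ x = real (λ n → - seq x n) (cauchy-neg {seq x} (cauchy x))

  fromℚ : ℚ → Real
  fromℚ p = real (λ _ → p) (cauchy-const p)

  ℝ : CommutativeRing 0ℓ 0ℓ
  ℝ = record
    { Carrier = Real ; _≈_ = _≈ʳ_ ; _+_ = _+ʳ_ ; _*_ = _*ʳ_ ; -_ = -ʳ_
    ; 0# = fromℚ 0ℚ ; 1# = fromℚ 1ℚ
    ; isCommutativeRing = record
      { isRing = record
        { +-isAbelianGroup = record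
          { isGroup = record
            { isMonoid = record
              { isSemigroup = record
                { isMagma = record
                  { isEquivalence = record
                    { refl  = λ {x} → pointwise {x} {x} λ _ → ≡.refl
                    ; sym   = λ {x} {y} p → null-≗ (λ n → ℚ-lemmas.neg-sub (seq x n) (seq y n)) (null-neg p)
                    ; trans = λ {x} {y} {z} p q →
                        null-≗ (λ n → ℚ-lemmas.telescope (seq x n) (seq y n) (seq z n)) (null-+ p q)
                    }
                  ; ∙-cong = λ {x} {y} {u} {v} p q →
                      null-≗ (λ n → ℚ-lemmas.sub-+ (seq x n) (seq y n) (seq u n) (seq v n)) (null-+ p q)
                  }
                ; assoc = λ x y z → pointwise {(x +ʳ y) +ʳ z} {x +ʳ (y +ʳ z)}
                    λ n → ℚₚ.+-assoc (seq x n) (seq y n) (seq z n)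
                }
              ; identity = (λ x → pointwise {fromℚ 0ℚ +ʳ x} {x} λ n → ℚₚ.+-identityˡ (seq x n))
                         , (λ x → pointwise {x +ʳ fromℚ 0ℚ} {x} λ n → ℚₚ.+-identityʳ (seq x n))
              }
            ; inverse = (λ x → pointwise {(-ʳ x) +ʳ x} {fromℚ 0ℚ} λ n → ℚₚ.+-inverseˡ (seq x n))
                      , (λ x → pointwise {x +ʳ (-ʳ x)} {fromℚ 0ℚ} λ n → ℚₚ.+-inverseʳ (seq x n))
            ; ⁻¹-cong = λ {x} {y} p → null-≗ (λ n → ℚₚ.neg-distrib-+ (seq x n) (- seq y n)) (null-neg p)
            }
          ; comm = λ x y → pointwise {x +ʳ y} {y +ʳ x} λ n → ℚₚ.+-comm (seq x n) (seq y n)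
          }
        ; *-cong = λ {x} {y} {u} {v} p q →
            null-≗ (λ n → ℚ-lemmas.sub-* (seq x n) (seq y n) (seq u n) (seq v n))
              (null-+ (null-* {seq x} (cauchy x) q) (null-* {seq v} (cauchy v) p))
        ; *-assoc = λ x y z → pointwise {(x *ʳ y) *ʳ z} {x *ʳ (y *ʳ z)}
            λ n → ℚₚ.*-assoc (seq x n) (seq y n) (seq z n)
        ; *-identity = (λ x → pointwise {fromℚ 1ℚ *ʳ x} {x} λ n → ℚₚ.*-identityˡ (seq x n))
                     , (λ x → pointwise {x *ʳ fromℚ 1ℚ} {x} λ n → ℚₚ.*-identityʳ (seq x n))
        ; distrib = (λ x y z → pointwise {x *ʳ (y +ʳ z)} {(x *ʳ y) +ʳ (x *ʳ z)}
                      λ n → ℚₚ.*-distribˡ-+ (seq x n) (seq y n) (seq z n))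
                  , (λ x y z → pointwise {(y +ʳ z) *ʳ x} {(y *ʳ x) +ʳ (z *ʳ x)}
                      λ n → ℚₚ.*-distribʳ-+ (seq x n) (seq y n) (seq z n))
        }
      ; *-comm = λ x y → pointwise {x *ʳ y} {y *ʳ x} λ n → ℚₚ.*-comm (seq x n) (seq y n)
      }
    }

module Fractions {c ℓ} (R : CommutativeRing c ℓ) where

  open CommutativeRing R
  open import Algebra.Properties.Ring ring
    using (-‿distribˡ-*; x[y-z]≈xy-xz; x∙y⁻¹≈ε⇒x≈y)
  open import Relation.Binary.Reasoning.Setoid setoid

  open import Algebra.Solver.Ring.NaturalCoefficients.Default commutativeSemiring
    using (solve; _:=_; _:+_; _:*_)

  Regular : Carrier → Set (c ⊔ ℓ)
  Regular r = ∀ a → r * a ≈ 0# → a ≈ 0#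

  regular-1 : Regular 1#
  regular-1 a 1a≈0 = trans (sym (*-identityˡ a)) 1a≈0

  regular-* : ∀ {r s} → Regular r → Regular s → Regular (r * s)
  regular-* {r} {s} reg-r reg-s a rsa≈0 =
    reg-s a (reg-r (s * a) (trans (sym (*-assoc r s a)) rsa≈0))

  regular-≈ : ∀ {r s} → r ≈ s → Regular r → Regular s
  regular-≈ r≈s reg-r a sa≈0 = reg-r a (trans (*-congʳ r≈s) sa≈0)

  private
    cancel : ∀ {r} → Regular r → ∀ {a b} → r * a ≈ r * b → a ≈ b
    cancel {r} reg-r {a} {b} ra≈rb = x∙y⁻¹≈ε⇒x≈y a b (reg-r (a - b) (begin
      r * (a - b)      ≈⟨ x[y-z]≈xy-xz r a b ⟩
      r * a - r * b    ≈⟨ +-congʳ ra≈rb ⟩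
      r * b - r * b    ≈⟨ -‿inverseʳ _ ⟩
      0#               ∎))

  -- The total ring of fractions: denominators are the non-zero-divisors. Over an
  -- integral domain such as ℝ[x₁, …, x_N] this is the field of fractions.
  record Fraction : Set (c ⊔ ℓ) where
    constructor fraction
    field
      num     : Carrier
      den     : Carrier
      regular : Regular den
  open Fraction

  infix 4 _≈ᶠ_
  _≈ᶠ_ : Fraction → Fraction → Set ℓ
  p ≈ᶠ q = num p * den q ≈ num q * den p

  _+ᶠ_ : Fraction → Fraction → Fraction
  p +ᶠ q = fraction (num p * den q + num q * den p) (den p * den q)
             (regular-* (regular p) (regular q))

  _*ᶠ_ : Fraction → Fraction → Fraction
  p *ᶠ q = fraction (num p * num q) (den p * den q) (regular-* (regular p) (regular q))

  -ᶠ_ : Fraction → Fraction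
  -ᶠ p = fraction (- num p) (den p) (regular p)

  embed : Carrier → Fraction
  embed a = fraction a 1# regular-1

  private
    transᶠ : ∀ {p q r} → p ≈ᶠ q → q ≈ᶠ r → p ≈ᶠ r
    transᶠ {p} {q} {r} p≈q q≈r = cancel (regular q) (begin
      den q * (num p * den r)      ≈⟨ solve 3 (λ a b d → (a :* (b :* d)) := ((b :* a) :* d)) refl (den q) (num p) (den r) ⟩
      (num p * den q) * den r      ≈⟨ *-congʳ p≈q ⟩
      (num q * den p) * den r      ≈⟨ solve 3 (λ a b d → ((a :* b) :* d) := ((a :* d) :* b)) refl (num q) (den p) (den r) ⟩
      (num q * den r) * den p      ≈⟨ *-congʳ q≈r ⟩
      (num r * den q) * den p      ≈⟨ solve 3 (λ a b d → ((a :* b) :* d) := (b :* (a :* d))) refl (num r) (den q) (den p) ⟩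
      den q * (num r * den p)      ∎)

    +ᶠ-cong : ∀ {p q r s} → p ≈ᶠ q → r ≈ᶠ s → (p +ᶠ r) ≈ᶠ (q +ᶠ s)
    +ᶠ-cong {fraction a b _} {fraction a′ b′ _} {fraction e d _} {fraction e′ d′ _} p≈q r≈s = begin
      (a * d + e * b) * (b′ * d′)
        ≈⟨ solve 6 (λ a b d e b′ d′ → ((a :* d :+ e :* b) :* (b′ :* d′)) := ((a :* b′) :* (d :* d′) :+ (e :* d′) :* (b :* b′))) refl a b d e b′ d′ ⟩
      (a * b′) * (d * d′) + (e * d′) * (b * b′)
        ≈⟨ +-cong (*-congʳ p≈q) (*-congʳ r≈s) ⟩
      (a′ * b) * (d * d′) + (e′ * d) * (b * b′)
        ≈⟨ solve 6 (λ a′ b d e′ b′ d′ → ((a′ :* b) :* (d :* d′) :+ (e′ :* d) :* (b :* b′)) := ((a′ :* d′ :+ e′ :* b′) :* (b :* d))) refl a′ b d e′ b′ d′ ⟩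
      (a′ * d′ + e′ * b′) * (b * d) ∎

    *ᶠ-cong : ∀ {p q r s} → p ≈ᶠ q → r ≈ᶠ s → (p *ᶠ r) ≈ᶠ (q *ᶠ s)
    *ᶠ-cong {fraction a b _} {fraction a′ b′ _} {fraction e d _} {fraction e′ d′ _} p≈q r≈s = begin
      (a * e) * (b′ * d′)
        ≈⟨ solve 4 (λ a e b′ d′ → ((a :* e) :* (b′ :* d′)) := ((a :* b′) :* (e :* d′))) refl a e b′ d′ ⟩
      (a * b′) * (e * d′)
        ≈⟨ *-cong p≈q r≈s ⟩
      (a′ * b) * (e′ * d)
        ≈⟨ solve 4 (λ a′ b e′ d → ((a′ :* b) :* (e′ :* d)) := ((a′ :* e′) :* (b :* d))) refl a′ b e′ d ⟩
      (a′ * e′) * (b * d) ∎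

    -ᶠ-cong : ∀ {p q} → p ≈ᶠ q → (-ᶠ p) ≈ᶠ (-ᶠ q)
    -ᶠ-cong {fraction a b _} {fraction a′ b′ _} p≈q = begin
      - a * b′      ≈⟨ -‿distribˡ-* a b′ ⟨
      - (a * b′)    ≈⟨ -‿cong p≈q ⟩
      - (a′ * b)    ≈⟨ -‿distribˡ-* a′ b ⟩
      - a′ * b      ∎

    +ᶠ-comm : ∀ p q → (p +ᶠ q) ≈ᶠ (q +ᶠ p)
    +ᶠ-comm (fraction a b _) (fraction e d _) =
      solve 4 (λ a b e d → ((a :* d :+ e :* b) :* (d :* b)) := ((e :* b :+ a :* d) :* (b :* d))) refl a b e d

    *ᶠ-comm : ∀ p q → (p *ᶠ q) ≈ᶠ (q *ᶠ p)
    *ᶠ-comm (fraction a b _) (fraction e d _) =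
      solve 4 (λ a b e d → ((a :* e) :* (d :* b)) := ((e :* a) :* (b :* d))) refl a b e d

    +ᶠ-assoc : ∀ p q r → ((p +ᶠ q) +ᶠ r) ≈ᶠ (p +ᶠ (q +ᶠ r))
    +ᶠ-assoc (fraction a b _) (fraction e d _) (fraction g h _) =
      solve 6 (λ a b e d g h →
        (((a :* d :+ e :* b) :* h :+ g :* (b :* d)) :* (b :* (d :* h)))
        := ((a :* (d :* h) :+ (e :* h :+ g :* d) :* b) :* ((b :* d) :* h))) refl a b e d g h

    *ᶠ-assoc : ∀ p q r → ((p *ᶠ q) *ᶠ r) ≈ᶠ (p *ᶠ (q *ᶠ r))
    *ᶠ-assoc (fraction a b _) (fraction e d _) (fraction g h _) =
      solve 6 (λ a b e d g h →
        (((a :* e) :* g) :* (b :* (d :* h))) := ((a :* (e :* g)) :* ((b :* d) :* h))) refl a b e d g h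

    *ᶠ-distribˡ : ∀ p q r → (p *ᶠ (q +ᶠ r)) ≈ᶠ ((p *ᶠ q) +ᶠ (p *ᶠ r))
    *ᶠ-distribˡ (fraction a b _) (fraction e d _) (fraction g h _) =
      solve 6 (λ a b e d g h →
        ((a :* (e :* h :+ g :* d)) :* ((b :* d) :* (b :* h)))
        := (((a :* e) :* (b :* h) :+ (a :* g) :* (b :* d)) :* (b :* (d :* h)))) refl a b e d g h

    +ᶠ-identityˡ : ∀ p → (embed 0# +ᶠ p) ≈ᶠ p
    +ᶠ-identityˡ (fraction a b _) = begin
      (0# * b + a * 1#) * b    ≈⟨ *-congʳ (+-cong (zeroˡ b) (*-comm a 1#)) ⟩
      (0# + 1# * a) * b        ≈⟨ *-congʳ (+-identityˡ _) ⟩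
      (1# * a) * b             ≈⟨ solve 3 (λ o a b → ((o :* a) :* b) := (a :* (o :* b))) refl 1# a b ⟩
      a * (1# * b)             ∎

    *ᶠ-identityˡ : ∀ p → (embed 1# *ᶠ p) ≈ᶠ p
    *ᶠ-identityˡ (fraction a b _) =
      solve 3 (λ o a b → ((o :* a) :* b) := (a :* (o :* b))) refl 1# a b

    -ᶠ-inverseˡ : ∀ p → ((-ᶠ p) +ᶠ p) ≈ᶠ embed 0#
    -ᶠ-inverseˡ (fraction a b _) = begin
      (- a * b + a * b) * 1#    ≈⟨ *-congʳ (distribʳ b (- a) a) ⟨
      (- a + a) * b * 1#        ≈⟨ *-congʳ (*-congʳ (-‿inverseˡ a)) ⟩
      0# * b * 1#               ≈⟨ *-assoc _ _ _ ⟩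
      0# * (b * 1#)             ≈⟨ zeroˡ _ ⟩
      0#                        ≈⟨ zeroˡ _ ⟨
      0# * (b * b)              ∎

  fractionRing : CommutativeRing (c ⊔ ℓ) ℓ
  fractionRing = record
    { Carrier = Fraction ; _≈_ = _≈ᶠ_ ; _+_ = _+ᶠ_ ; _*_ = _*ᶠ_ ; -_ = -ᶠ_
    ; 0# = embed 0# ; 1# = embed 1#
    ; isCommutativeRing = record
      { isRing = record
        { +-isAbelianGroup = record
          { isGroup = record
            { isMonoid = record
              { isSemigroup = record
                { isMagma = record
                  { isEquivalence = record
                    { refl  = refl
                    ; sym   = sym
                    ; trans = λ {p} {q} {r} → transᶠ {p} {q} {r}
                    }
                  ; ∙-cong = λ {p} {q} {r} {s} → +ᶠ-cong {p} {q} {r} {s}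
                  }
                ; assoc = +ᶠ-assoc
                }
              ; identity = +ᶠ-identityˡ
                         , (λ p → transᶠ {p +ᶠ embed 0#} {embed 0# +ᶠ p} {p} (+ᶠ-comm p (embed 0#)) (+ᶠ-identityˡ p))
              }
            ; inverse = -ᶠ-inverseˡ
                      , (λ p → transᶠ {p +ᶠ (-ᶠ p)} {(-ᶠ p) +ᶠ p} {embed 0#} (+ᶠ-comm p (-ᶠ p)) (-ᶠ-inverseˡ p))
            ; ⁻¹-cong = λ {p} {q} → -ᶠ-cong {p} {q}
            }
          ; comm = +ᶠ-comm
          }
        ; *-cong = λ {p} {q} {r} {s} → *ᶠ-cong {p} {q} {r} {s}
        ; *-assoc = *ᶠ-assoc
        ; *-identity = *ᶠ-identityˡ
                     , (λ p → transᶠ {p *ᶠ embed 1#} {embed 1# *ᶠ p} {p} (*ᶠ-comm p (embed 1#)) (*ᶠ-identityˡ p))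
        ; distrib = *ᶠ-distribˡ
                  , (λ p q r → transᶠ {(q +ᶠ r) *ᶠ p} {p *ᶠ (q +ᶠ r)} {(q *ᶠ p) +ᶠ (r *ᶠ p)}
                      (*ᶠ-comm (q +ᶠ r) p)
                      (transᶠ {p *ᶠ (q +ᶠ r)} {(p *ᶠ q) +ᶠ (p *ᶠ r)} {(q *ᶠ p) +ᶠ (r *ᶠ p)}
                        (*ᶠ-distribˡ p q r)
                        (+ᶠ-cong {p *ᶠ q} {q *ᶠ p} {p *ᶠ r} {r *ᶠ p} (*ᶠ-comm p q) (*ᶠ-comm p r))))
        }
      ; *-comm = *ᶠ-comm
      }
    }

module Polynomials {c ℓ} (R : CommutativeRing c ℓ) (N : ℕ) where

  open CommutativeRing R hiding (zero)
  open import Algebra.Properties.Ring ring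
    using (-‿distribˡ-*; -‿+-comm; -0#≈0#; x∙y⁻¹≈ε⇒x≈y)
  open import Algebra.Properties.CommutativeSemigroup +-commutativeSemigroup
    using (interchange)
  open import Algebra.Properties.CommutativeSemigroup *-commutativeSemigroup
    using (x∙yz≈y∙xz)
  open import Relation.Binary.Reasoning.Setoid setoid

  Monomial : Set
  Monomial = Vec ℕ N

  _·_ : Monomial → Monomial → Monomial
  _·_ = Vec.zipWith Nat._+_

  𝟏 : Monomial
  𝟏 = Vec.replicate N 0

  _≟ᵐ_ : (e m : Monomial) → Dec (e ≡ m)
  _≟ᵐ_ = Vecₚ.≡-dec ℕₚ._≟_

  -- Finite formal sums of terms; terms with the same monomial may be repeated,
  -- and two polynomials are equal when all their coefficients are.
  Polynomial : Set c
  Polynomial = List (Carrier × Monomial)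

  δ : Monomial → Monomial → Carrier
  δ e m = if does (e ≟ᵐ m) then 1# else 0#

  -- The linear extension of φ from monomials to polynomials.
  extend : Polynomial → (Monomial → Carrier) → Carrier
  extend p φ = List.foldr (λ (a , e) r → a * φ e + r) 0# p

  coeff : Polynomial → Monomial → Carrier
  coeff p m = extend p (λ e → δ e m)

  infix 4 _≈ᵖ_
  _≈ᵖ_ : Polynomial → Polynomial → Set ℓ
  p ≈ᵖ q = ∀ m → coeff p m ≈ coeff q m

  _*ᵖ_ : Polynomial → Polynomial → Polynomial
  _*ᵖ_ = List.cartesianProductWith (λ (a , e) (b , f) → a * b , e · f)

  -ᵖ_ : Polynomial → Polynomial
  -ᵖ_ = List.map λ (a , e) → - a , e

  const : Carrier → Polynomial
  const a = List.[ a , 𝟏 ]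

  var : Fin N → Polynomial
  var j = List.[ 1# , 𝟏 Vec.[ j ]≔ 1 ]

  ·-comm : ∀ e f → e · f ≡ f · e
  ·-comm = Vecₚ.zipWith-comm ℕₚ.+-comm

  ·-assoc : ∀ e f g → (e · f) · g ≡ e · (f · g)
  ·-assoc = Vecₚ.zipWith-assoc ℕₚ.+-assoc

  ·-identityˡ : ∀ e → 𝟏 · e ≡ e
  ·-identityˡ = Vecₚ.zipWith-identityˡ ℕₚ.+-identityˡ

  lookup-· : ∀ e f j → Vec.lookup (e · f) j ≡ Vec.lookup e j Nat.+ Vec.lookup f j
  lookup-· e f j = Vecₚ.lookup-zipWith Nat._+_ j e f

  ext : ∀ {e f : Monomial} → (∀ j → Vec.lookup e j ≡ Vec.lookup f j) → e ≡ f
  ext {e} {f} eq = ≡.trans (≡.sym (Vecₚ.tabulate∘lookup e))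
    (≡.trans (Vecₚ.tabulate-cong eq) (Vecₚ.tabulate∘lookup f))

  ·-cancelˡ : ∀ e {f g} → e · f ≡ e · g → f ≡ g
  ·-cancelˡ e {f} {g} eq = ext λ j → ℕₚ.+-cancelˡ-≡ (Vec.lookup e j) _ _
    (≡.trans (≡.sym (lookup-· e f j))
      (≡.trans (≡.cong (λ m → Vec.lookup m j) eq) (lookup-· e g j)))

  _÷_ : Monomial → Monomial → Monomial
  _÷_ = Vec.zipWith Nat._∸_

  ·-÷ : ∀ e f → (e · f) ÷ e ≡ f
  ·-÷ e f = ext λ j → ≡.trans (Vecₚ.lookup-zipWith Nat._∸_ j (e · f) e)
    (≡.trans (≡.cong (Nat._∸ Vec.lookup e j) (lookup-· e f j))
      (ℕₚ.m+n∸m≡n (Vec.lookup e j) (Vec.lookup f j)))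

  δ-≡ : ∀ {e m} → e ≡ m → δ e m ≈ 1#
  δ-≡ {e} {m} eq rewrite dec-true (e ≟ᵐ m) eq = refl

  δ-≢ : ∀ {e m} → e ≢ m → δ e m ≈ 0#
  δ-≢ {e} {m} ne rewrite dec-false (e ≟ᵐ m) ne = refl

  δ-· : ∀ e f m → δ (e · f) (e · m) ≈ δ f m
  δ-· e f m with f ≟ᵐ m
  ... | yes eq = δ-≡ (≡.cong (e ·_) eq)
  ... | no ne = δ-≢ (ne ∘ ·-cancelˡ e)

  extend-cong : ∀ p {φ ψ} → (∀ e → φ e ≈ ψ e) → extend p φ ≈ extend p ψ
  extend-cong [] φ≈ψ = refl
  extend-cong ((a , e) ∷ p) φ≈ψ = +-cong (*-congˡ (φ≈ψ e)) (extend-cong p φ≈ψ)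

  extend-++ : ∀ p q φ → extend (p ++ q) φ ≈ extend p φ + extend q φ
  extend-++ [] q φ = sym (+-identityˡ _)
  extend-++ ((a , e) ∷ p) q φ = trans (+-congˡ (extend-++ p q φ)) (sym (+-assoc _ _ _))

  extend-neg : ∀ p φ → extend (-ᵖ p) φ ≈ - extend p φ
  extend-neg [] φ = sym -0#≈0#
  extend-neg ((a , e) ∷ p) φ =
    trans (+-cong (sym (-‿distribˡ-* a (φ e))) (extend-neg p φ)) (-‿+-comm _ _)

  extend-0 : ∀ p → extend p (λ _ → 0#) ≈ 0#
  extend-0 [] = refl
  extend-0 ((a , e) ∷ p) = trans (+-cong (zeroʳ a) (extend-0 p)) (+-identityˡ _)

  extend-+ : ∀ p φ ψ → extend p (λ e → φ e + ψ e) ≈ extend p φ + extend p ψ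
  extend-+ [] φ ψ = sym (+-identityˡ _)
  extend-+ ((a , e) ∷ p) φ ψ =
    trans (+-cong (distribˡ a (φ e) (ψ e)) (extend-+ p φ ψ)) (interchange _ _ _ _)

  extend-scale : ∀ p a φ → extend p (λ e → a * φ e) ≈ a * extend p φ
  extend-scale [] a φ = sym (zeroʳ a)
  extend-scale ((b , e) ∷ p) a φ =
    trans (+-cong (x∙yz≈y∙xz b a (φ e)) (extend-scale p a φ)) (sym (distribˡ a _ _))

  extend-swap : ∀ p q (χ : Monomial → Monomial → Carrier) → extend p (λ e → extend q (λ f → χ e f)) ≈
                          extend q (λ f → extend p (λ e → χ e f))
  extend-swap [] q χ = sym (extend-0 q)
  extend-swap ((a , e) ∷ p) q χ = begin
    a * extend q (χ e) + extend p (λ e → extend q (χ e))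
      ≈⟨ +-cong (sym (extend-scale q a (χ e))) (extend-swap p q χ) ⟩
    extend q (λ f → a * χ e f) + extend q (λ f → extend p (λ e → χ e f))
      ≈⟨ extend-+ q _ _ ⟨
    extend q (λ f → a * χ e f + extend p (λ e → χ e f)) ∎

  extend-* : ∀ p q φ → extend (p *ᵖ q) φ ≈ extend p (λ e → extend q (λ f → φ (e · f)))
  extend-* [] q φ = refl
  extend-* ((a , e) ∷ p) q φ =
    trans (extend-++ (List.map _ q) (p *ᵖ q) φ) (+-cong (term q) (extend-* p q φ))
    where
    term : ∀ q → extend (List.map (λ (b , f) → a * b , e · f) q) φ ≈
                 a * extend q (λ f → φ (e · f))
    term [] = sym (zeroʳ a)
    term ((b , f) ∷ q) = trans (+-cong (*-assoc a b _) (term q)) (sym (distribˡ a _ _))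

  shift-cong : ∀ p q → p ≈ᵖ q → ∀ e m →
               extend p (λ f → δ (e · f) m) ≈ extend q (λ f → δ (e · f) m)
  shift-cong p q p≈q e m with (e · (m ÷ e)) ≟ᵐ m
  ... | yes eq = begin
    extend p (λ f → δ (e · f) m)    ≈⟨ extend-cong p same ⟩
    coeff p (m ÷ e)                 ≈⟨ p≈q (m ÷ e) ⟩
    coeff q (m ÷ e)                 ≈⟨ extend-cong q same ⟨
    extend q (λ f → δ (e · f) m)    ∎
    where
    same : ∀ f → δ (e · f) m ≈ δ f (m ÷ e)
    same f = ≡.subst (λ n → δ (e · f) n ≈ δ f (m ÷ e)) eq (δ-· e f (m ÷ e))
  ... | no ne = trans (extend-cong p none)
                  (trans (extend-0 p) (sym (trans (extend-cong q none) (extend-0 q))))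
    where
    none : ∀ f → δ (e · f) m ≈ 0#
    none f = δ-≢ {e · f} {m} λ { ≡.refl → ne (≡.cong (e ·_) (·-÷ e f)) }

  *ᵖ-comm : ∀ p q → (p *ᵖ q) ≈ᵖ (q *ᵖ p)
  *ᵖ-comm p q m = begin
    coeff (p *ᵖ q) m                                     ≈⟨ extend-* p q _ ⟩
    extend p (λ e → extend q (λ f → δ (e · f) m))        ≈⟨ extend-swap p q _ ⟩
    extend q (λ f → extend p (λ e → δ (e · f) m))
      ≈⟨ extend-cong q (λ f → extend-cong p λ e → reflexive (≡.cong (λ g → δ g m) (·-comm e f))) ⟩
    extend q (λ f → extend p (λ e → δ (f · e) m))        ≈⟨ extend-* q p _ ⟨
    coeff (q *ᵖ p) m                                     ∎

  *ᵖ-congˡ : ∀ p q r → q ≈ᵖ r → (p *ᵖ q) ≈ᵖ (p *ᵖ r)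
  *ᵖ-congˡ p q r q≈r m = begin
    coeff (p *ᵖ q) m                                     ≈⟨ extend-* p q _ ⟩
    extend p (λ e → extend q (λ f → δ (e · f) m))        ≈⟨ extend-cong p (λ e → shift-cong q r q≈r e m) ⟩
    extend p (λ e → extend r (λ f → δ (e · f) m))        ≈⟨ extend-* p r _ ⟨
    coeff (p *ᵖ r) m                                     ∎

  *ᵖ-cong : ∀ p q r s → p ≈ᵖ q → r ≈ᵖ s → (p *ᵖ r) ≈ᵖ (q *ᵖ s)
  *ᵖ-cong p q r s p≈q r≈s m = begin
    coeff (p *ᵖ r) m    ≈⟨ *ᵖ-congˡ p r s r≈s m ⟩
    coeff (p *ᵖ s) m    ≈⟨ *ᵖ-comm p s m ⟩
    coeff (s *ᵖ p) m    ≈⟨ *ᵖ-congˡ s p q p≈q m ⟩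
    coeff (s *ᵖ q) m    ≈⟨ *ᵖ-comm s q m ⟩
    coeff (q *ᵖ s) m    ∎

  *ᵖ-assoc : ∀ p q r → ((p *ᵖ q) *ᵖ r) ≈ᵖ (p *ᵖ (q *ᵖ r))
  *ᵖ-assoc p q r m = begin
    coeff ((p *ᵖ q) *ᵖ r) m
      ≈⟨ extend-* (p *ᵖ q) r _ ⟩
    extend (p *ᵖ q) (λ e → extend r (λ g → δ (e · g) m))
      ≈⟨ extend-* p q _ ⟩
    extend p (λ e → extend q (λ f → extend r (λ g → δ ((e · f) · g) m)))
      ≈⟨ extend-cong p (λ e → extend-cong q λ f → extend-cong r λ g →
           reflexive (≡.cong (λ h → δ h m) (·-assoc e f g))) ⟩
    extend p (λ e → extend q (λ f → extend r (λ g → δ (e · (f · g)) m)))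
      ≈⟨ extend-cong p (λ e → extend-* q r _) ⟨
    extend p (λ e → extend (q *ᵖ r) (λ h → δ (e · h) m))
      ≈⟨ extend-* p (q *ᵖ r) _ ⟨
    coeff (p *ᵖ (q *ᵖ r)) m ∎

  *ᵖ-identityˡ : ∀ p → (const 1# *ᵖ p) ≈ᵖ p
  *ᵖ-identityˡ p m = begin
    coeff (const 1# *ᵖ p) m                        ≈⟨ extend-* (const 1#) p _ ⟩
    1# * extend p (λ f → δ (𝟏 · f) m) + 0#         ≈⟨ +-identityʳ _ ⟩
    1# * extend p (λ f → δ (𝟏 · f) m)              ≈⟨ *-identityˡ _ ⟩
    extend p (λ f → δ (𝟏 · f) m)
      ≈⟨ extend-cong p (λ f → reflexive (≡.cong (λ g → δ g m) (·-identityˡ f))) ⟩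
    coeff p m                                      ∎

  *ᵖ-distribˡ : ∀ p q r → (p *ᵖ (q ++ r)) ≈ᵖ ((p *ᵖ q) ++ (p *ᵖ r))
  *ᵖ-distribˡ p q r m = begin
    coeff (p *ᵖ (q ++ r)) m
      ≈⟨ extend-* p (q ++ r) _ ⟩
    extend p (λ e → extend (q ++ r) (λ f → δ (e · f) m))
      ≈⟨ extend-cong p (λ e → extend-++ q r _) ⟩
    extend p (λ e → extend q (λ f → δ (e · f) m) + extend r (λ f → δ (e · f) m))
      ≈⟨ extend-+ p _ _ ⟩
    extend p (λ e → extend q (λ f → δ (e · f) m)) + extend p (λ e → extend r (λ f → δ (e · f) m))
      ≈⟨ +-cong (extend-* p q _) (extend-* p r _) ⟨
    coeff (p *ᵖ q) m + coeff (p *ᵖ r) m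
      ≈⟨ extend-++ (p *ᵖ q) (p *ᵖ r) _ ⟨
    coeff ((p *ᵖ q) ++ (p *ᵖ r)) m ∎

  ++-cong : ∀ p q r s → p ≈ᵖ q → r ≈ᵖ s → (p ++ r) ≈ᵖ (q ++ s)
  ++-cong p q r s p≈q r≈s m =
    trans (extend-++ p r _) (trans (+-cong (p≈q m) (r≈s m)) (sym (extend-++ q s _)))

  ++-comm : ∀ p q → (p ++ q) ≈ᵖ (q ++ p)
  ++-comm p q m = trans (extend-++ p q _) (trans (+-comm _ _) (sym (extend-++ q p _)))

  -ᵖ-inverseˡ : ∀ p → ((-ᵖ p) ++ p) ≈ᵖ []
  -ᵖ-inverseˡ p m = trans (extend-++ (-ᵖ p) p _)
    (trans (+-congʳ (extend-neg p _)) (-‿inverseˡ _))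

  polynomialRing : CommutativeRing c ℓ
  polynomialRing = record
    { Carrier = Polynomial ; _≈_ = _≈ᵖ_ ; _+_ = _++_ ; _*_ = _*ᵖ_ ; -_ = -ᵖ_
    ; 0# = [] ; 1# = const 1#
    ; isCommutativeRing = record
      { isRing = record
        { +-isAbelianGroup = record
          { isGroup = record
            { isMonoid = record
              { isSemigroup = record
                { isMagma = record
                  { isEquivalence = record
                    { refl  = λ _ → refl
                    ; sym   = λ p≈q m → sym (p≈q m)
                    ; trans = λ p≈q q≈r m → trans (p≈q m) (q≈r m)
                    }
                  ; ∙-cong = λ {p} {q} {r} {s} → ++-cong p q r s
                  }
                ; assoc = λ p q r m → reflexive (≡.cong (λ s → coeff s m) (Listₚ.++-assoc p q r))
                }
              ; identity = (λ p m → refl)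
                         , (λ p m → reflexive (≡.cong (λ s → coeff s m) (Listₚ.++-identityʳ p)))
              }
            ; inverse = -ᵖ-inverseˡ
                      , (λ p m → trans (++-comm p (-ᵖ p) m) (-ᵖ-inverseˡ p m))
            ; ⁻¹-cong = λ {p} {q} p≈q m →
                trans (extend-neg p _) (trans (-‿cong (p≈q m)) (sym (extend-neg q _)))
            }
          ; comm = ++-comm
          }
        ; *-cong = λ {p} {q} {r} {s} → *ᵖ-cong p q r s
        ; *-assoc = *ᵖ-assoc
        ; *-identity = *ᵖ-identityˡ
                     , (λ p m → trans (*ᵖ-comm p (const 1#) m) (*ᵖ-identityˡ p m))
        ; distrib = *ᵖ-distribˡ
                  , (λ p q r m → trans (*ᵖ-comm (q ++ r) p m)
                      (trans (*ᵖ-distribˡ p q r m)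
                        (++-cong (p *ᵖ q) (q *ᵖ p) (p *ᵖ r) (r *ᵖ p)
                          (*ᵖ-comm p q) (*ᵖ-comm p r) m)))
        }
      ; *-comm = *ᵖ-comm
      }
    }

  𝐞 : Fin N → Monomial
  𝐞 j = 𝟏 Vec.[ j ]≔ 1

  𝐞-self : ∀ j → Vec.lookup (𝐞 j) j ≡ 1
  𝐞-self j = Vecₚ.lookup∘update j 𝟏 1

  𝐞-other : ∀ {j k} → j ≢ k → Vec.lookup (𝐞 k) j ≡ 0
  𝐞-other {j} {k} j≢k = ≡.trans (Vecₚ.lookup∘update′ j≢k 𝟏 1) (Vecₚ.lookup-replicate j 0)

  lookup-𝐞· : ∀ {j k} → j ≢ k → ∀ m → Vec.lookup (𝐞 k · m) j ≡ Vec.lookup m j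
  lookup-𝐞· {j} {k} j≢k m =
    ≡.trans (lookup-· (𝐞 k) m j) (≡.cong (Nat._+ Vec.lookup m j) (𝐞-other j≢k))

  divide : ∀ j m {t} → Vec.lookup m j ≡ suc t →
           ∃ λ m′ → m ≡ 𝐞 j · m′ × Vec.lookup m′ j ≡ t
  divide j m {t} mj≡ = m Vec.[ j ]≔ t , ext at , Vecₚ.lookup∘update j m t
    where
    at : ∀ i → Vec.lookup m i ≡ Vec.lookup (𝐞 j · (m Vec.[ j ]≔ t)) i
    at i with i Finₚ.≟ j
    ... | yes ≡.refl = ≡.trans mj≡ (≡.sym (≡.trans (lookup-· (𝐞 j) _ i)
            (≡.cong₂ Nat._+_ (𝐞-self i) (Vecₚ.lookup∘update i m t))))
    ... | no i≢j = ≡.sym (≡.trans (lookup-𝐞· i≢j _) (Vecₚ.lookup∘update′ i≢j m t))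

  open Fractions polynomialRing using (Regular)

  var-var-regular : ∀ {j k} → j ≢ k → Regular (var k ++ (-ᵖ var j))
  var-var-regular {j} {k} j≢k p xp≈0 m = go (Vec.lookup m j) m ≡.refl
    where
    shifted : Fin N → Monomial → Carrier
    shifted i m = extend p (λ f → δ (𝐞 i · f) m)

    shifted-· : ∀ i m → shifted i (𝐞 i · m) ≈ coeff p m
    shifted-· i m = extend-cong p λ f → δ-· (𝐞 i) f m

    balance : ∀ m → coeff p m ≈ shifted j (𝐞 k · m)
    balance m = x∙y⁻¹≈ε⇒x≈y _ _ (begin
      coeff p m - shifted j (𝐞 k · m)
        ≈⟨ +-cong (trans (*-identityˡ _) (shifted-· k m))
                  (trans (+-identityʳ _) (trans (sym (-‿distribˡ-* 1# _)) (-‿cong (*-identityˡ _)))) ⟨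
      1# * shifted k (𝐞 k · m) + (- 1# * shifted j (𝐞 k · m) + 0#)
        ≈⟨ extend-* (var k ++ (-ᵖ var j)) p _ ⟨
      coeff ((var k ++ (-ᵖ var j)) *ᵖ p) (𝐞 k · m)
        ≈⟨ xp≈0 (𝐞 k · m) ⟩
      0# ∎)

    go : ∀ t m → Vec.lookup m j ≡ t → coeff p m ≈ 0#
    go zero m mj≡0 = trans (balance m) (trans (extend-cong p λ f → δ-≢ (absurd f)) (extend-0 p))
      where
      absurd : ∀ f → 𝐞 j · f ≢ 𝐞 k · m
      absurd f eq = contradiction
        (≡.trans (≡.sym (≡.trans (lookup-· (𝐞 j) f j) (≡.cong (Nat._+ Vec.lookup f j) (𝐞-self j))))
          (≡.trans (≡.cong (λ n → Vec.lookup n j) eq) (≡.trans (lookup-𝐞· j≢k m) mj≡0)))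
        λ ()
    go (suc t) m mj≡ with divide j m mj≡
    ... | m′ , ≡.refl , m′j≡t = begin
      coeff p (𝐞 j · m′)               ≈⟨ balance (𝐞 j · m′) ⟩
      shifted j (𝐞 k · (𝐞 j · m′))     ≈⟨ reflexive (≡.cong (shifted j) (swap m′)) ⟩
      shifted j (𝐞 j · (𝐞 k · m′))     ≈⟨ shifted-· j _ ⟩
      coeff p (𝐞 k · m′)               ≈⟨ go t (𝐞 k · m′) (≡.trans (lookup-𝐞· j≢k m′) m′j≡t) ⟩
      0#                               ∎
      where
      swap : ∀ m → 𝐞 k · (𝐞 j · m) ≡ 𝐞 j · (𝐞 k · m)
      swap m = ≡.trans (≡.sym (·-assoc (𝐞 k) (𝐞 j) m))
        (≡.trans (≡.cong (_· m) (·-comm (𝐞 k) (𝐞 j))) (·-assoc (𝐞 j) (𝐞 k) m))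

module Determinants {c ℓ} (R : CommutativeRing c ℓ) where

  open CommutativeRing R hiding (zero)
  open import Algebra.Properties.Ring ring using (-‿distribˡ-*; -1*x≈-x)
  open import Algebra.Properties.Semiring.Exp semiring using (_^_)
  open import Algebra.Properties.Semiring.Sum semiring
    using (sum; sum-cong-≋; ∑-distrib-+; *-distribˡ-sum; sum-replicate-zero)
  open import Algebra.Properties.CommutativeMonoid.Sum *-commutativeMonoid
    using () renaming (sum to prod)
  open import Algebra.Solver.Ring.NaturalCoefficients.Default commutativeSemiring
    using (solve; _:=_; _:+_; _:*_)
  open import Relation.Binary.Reasoning.Setoid setoid
  open Fractions R using (Regular; regular-1; regular-*; regular-≈)

  Matrix : ℕ → ℕ → Set c
  Matrix m n = Fin m → Fin n → Carrier

  minor : ∀ {n} → Matrix (suc n) (suc n) → Fin (suc n) → Matrix n n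
  minor A i a b = A (punchIn i a) (suc b)

  -- Laplace expansion along the first column.
  det : ∀ {n} → Matrix n n → Carrier
  det {zero}  A = 1#
  det {suc n} A = sum λ i → (- 1#) ^ toℕ i * (A i zero * det (minor A i))

  sum-zero : ∀ {n} {f : Fin n → Carrier} → (∀ i → f i ≈ 0#) → sum f ≈ 0#
  sum-zero {n} f≈0 = trans (sum-cong-≋ f≈0) (sum-replicate-zero n)

  det-cong : ∀ {n} {A B : Matrix n n} → (∀ i j → A i j ≈ B i j) → det A ≈ det B
  det-cong {zero}  A≈B = refl
  det-cong {suc n} A≈B = sum-cong-≋ λ i → *-congˡ {(- 1#) ^ toℕ i}
    (*-cong (A≈B i zero) (det-cong λ a b → A≈B (punchIn i a) (suc b)))

  det-scale : ∀ {n} (y : Fin n → Carrier) (A : Matrix n n) →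
              det (λ i j → y j * A i j) ≈ prod y * det A
  det-scale {zero}  y A = sym (*-identityˡ 1#)
  det-scale {suc n} y A = begin
    sum (λ i → (- 1#) ^ toℕ i * ((y zero * A i zero) * det (λ a b → y (suc b) * minor A i a b)))
      ≈⟨ sum-cong-≋ (λ i → trans (*-congˡ (*-congˡ (det-scale (y ∘ suc) (minor A i))))
           (solve 5 (λ s x a p d → s :* ((x :* a) :* (p :* d)) := (x :* p) :* (s :* (a :* d))) refl
             ((- 1#) ^ toℕ i) (y zero) (A i zero) (prod (y ∘ suc)) (det (minor A i)))) ⟩
    sum (λ i → prod y * ((- 1#) ^ toℕ i * (A i zero * det (minor A i))))
      ≈⟨ *-distribˡ-sum (prod y) (λ i → (- 1#) ^ toℕ i * (A i zero * det (minor A i))) ⟨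
    prod y * det A ∎

  det-linear : ∀ {n} (r : Fin n) t (A B C : Matrix n n) →
               (∀ i → i ≢ r → ∀ j → C i j ≈ A i j) →
               (∀ i → i ≢ r → ∀ j → C i j ≈ B i j) →
               (∀ j → C r j ≈ A r j + t * B r j) →
               det C ≈ det A + t * det B
  det-linear {suc n} r t A B C C≈A C≈B Cr = begin
    det C
      ≈⟨ sum-cong-≋ term ⟩
    sum (λ i → (- 1#) ^ toℕ i * (A i zero * det (minor A i)) +
               t * ((- 1#) ^ toℕ i * (B i zero * det (minor B i))))
      ≈⟨ ∑-distrib-+ (λ i → (- 1#) ^ toℕ i * (A i zero * det (minor A i)))
           (λ i → t * ((- 1#) ^ toℕ i * (B i zero * det (minor B i)))) ⟩
    det A + sum (λ i → t * ((- 1#) ^ toℕ i * (B i zero * det (minor B i))))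
      ≈⟨ +-congˡ (*-distribˡ-sum t (λ i → (- 1#) ^ toℕ i * (B i zero * det (minor B i)))) ⟨
    det A + t * det B ∎
    where
    term : ∀ i → (- 1#) ^ toℕ i * (C i zero * det (minor C i)) ≈
                 (- 1#) ^ toℕ i * (A i zero * det (minor A i)) +
                 t * ((- 1#) ^ toℕ i * (B i zero * det (minor B i)))
    term i with i Finₚ.≟ r
    ... | yes ≡.refl = begin
      s * (C i zero * det (minor C i))
        ≈⟨ *-congˡ (*-congʳ (Cr zero)) ⟩
      s * ((A i zero + t * B i zero) * det (minor C i))
        ≈⟨ solve 5 (λ s a t b d → s :* ((a :+ t :* b) :* d) := s :* (a :* d) :+ t :* (s :* (b :* d))) refl
             s (A i zero) t (B i zero) (det (minor C i)) ⟩
      s * (A i zero * det (minor C i)) + t * (s * (B i zero * det (minor C i)))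
        ≈⟨ +-cong (*-congˡ (*-congˡ (det-cong λ a b → C≈A (punchIn i a) (Finₚ.punchInᵢ≢i i a) (suc b))))
             (*-congˡ (*-congˡ (*-congˡ (det-cong λ a b → C≈B (punchIn i a) (Finₚ.punchInᵢ≢i i a) (suc b))))) ⟩
      s * (A i zero * det (minor A i)) + t * (s * (B i zero * det (minor B i))) ∎
      where
      s : Carrier
      s = (- 1#) ^ toℕ i
    ... | no i≢r = begin
      s * (C i zero * det (minor C i))
        ≈⟨ *-congˡ (*-congˡ (det-linear (punchOut i≢r) t (minor A i) (minor B i) (minor C i)
             (λ a a≢ b → C≈A (punchIn i a) (avoid a a≢) (suc b))
             (λ a a≢ b → C≈B (punchIn i a) (avoid a a≢) (suc b))
             (λ b → ≡.subst (λ q → C q (suc b) ≈ A q (suc b) + t * B q (suc b))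
                      (≡.sym (Finₚ.punchIn-punchOut i≢r)) (Cr (suc b))))) ⟩
      s * (C i zero * (det (minor A i) + t * det (minor B i)))
        ≈⟨ solve 5 (λ s x a t b → s :* (x :* (a :+ t :* b)) := s :* (x :* a) :+ t :* (s :* (x :* b))) refl
             s (C i zero) (det (minor A i)) t (det (minor B i)) ⟩
      s * (C i zero * det (minor A i)) + t * (s * (C i zero * det (minor B i)))
        ≈⟨ +-cong (*-congˡ (*-congʳ (C≈A i i≢r zero))) (*-congˡ (*-congˡ (*-congʳ (C≈B i i≢r zero)))) ⟩
      s * (A i zero * det (minor A i)) + t * (s * (B i zero * det (minor B i))) ∎
      where
      s : Carrier
      s = (- 1#) ^ toℕ i
      avoid : ∀ a → a ≢ punchOut i≢r → punchIn i a ≢ r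
      avoid a a≢ eq = a≢ (Finₚ.punchIn-injective i a (punchOut i≢r)
        (≡.trans eq (≡.sym (Finₚ.punchIn-punchOut i≢r))))

  private
    sum-adjacent : ∀ {n} (k : Fin n) (h : Fin (suc n) → Carrier) →
                   (∀ i → i ≢ inject₁ k → i ≢ suc k → h i ≈ 0#) →
                   h (inject₁ k) + h (suc k) ≈ 0# → sum h ≈ 0#
    sum-adjacent zero h else0 pair0 = begin
      h zero + (h (suc zero) + sum (λ i → h (suc (suc i))))
        ≈⟨ +-assoc _ _ _ ⟨
      h zero + h (suc zero) + sum (λ i → h (suc (suc i)))
        ≈⟨ +-cong pair0 (sum-zero λ i → else0 (suc (suc i)) (λ ()) (λ ())) ⟩
      0# + 0#
        ≈⟨ +-identityˡ 0# ⟩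
      0# ∎
    sum-adjacent (suc k) h else0 pair0 = trans
      (+-cong (else0 zero (λ ()) (λ ()))
        (sum-adjacent k (h ∘ suc)
          (λ i i≢ i≢′ → else0 (suc i) (i≢ ∘ Finₚ.suc-injective) (i≢′ ∘ Finₚ.suc-injective)) pair0))
      (+-identityˡ 0#)

    punch-adjacent : ∀ {n} (k : Fin (suc n)) (i : Fin (suc (suc n))) →
                     i ≢ inject₁ k → i ≢ suc k →
                     ∃ λ k′ → punchIn i (suc k′) ≡ suc k × punchIn i (inject₁ k′) ≡ inject₁ k
    punch-adjacent zero zero i≢ i≢′ = contradiction ≡.refl i≢
    punch-adjacent zero (suc zero) i≢ i≢′ = contradiction ≡.refl i≢′
    punch-adjacent {suc n} zero (suc (suc i)) i≢ i≢′ = zero , ≡.refl , ≡.refl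
    punch-adjacent (suc k) zero i≢ i≢′ = k , ≡.refl , ≡.refl
    punch-adjacent {suc n} (suc k) (suc i) i≢ i≢′
      with punch-adjacent k i (i≢ ∘ ≡.cong suc) (i≢′ ∘ ≡.cong suc)
    ... | k′ , eq , eq′ = suc k′ , ≡.cong suc eq , ≡.cong suc eq′

    punch-inject₁ : ∀ {n} (k : Fin n) → punchIn (inject₁ k) k ≡ suc k
    punch-inject₁ zero = ≡.refl
    punch-inject₁ (suc k) = ≡.cong suc (punch-inject₁ k)

    punch-suc : ∀ {n} (k : Fin n) → punchIn (suc k) k ≡ inject₁ k
    punch-suc zero = ≡.refl
    punch-suc (suc k) = ≡.cong suc (punch-suc k)

    punch-other : ∀ {n} (k a : Fin n) → a ≢ k → punchIn (inject₁ k) a ≡ punchIn (suc k) a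
    punch-other zero zero a≢ = contradiction ≡.refl a≢
    punch-other zero (suc a) a≢ = ≡.refl
    punch-other (suc k) zero a≢ = ≡.refl
    punch-other (suc k) (suc a) a≢ = ≡.cong suc (punch-other k a (a≢ ∘ ≡.cong suc))

  det-row-add : ∀ {n} (k : Fin n) t (A A′ : Matrix (suc n) (suc n)) →
                (∀ i → i ≢ suc k → ∀ j → A′ i j ≈ A i j) →
                (∀ j → A′ (suc k) j ≈ A (suc k) j + t * A (inject₁ k) j) →
                det A′ ≈ det A
  det-row-add {suc n} k t A A′ same add = begin
    det A′                    ≈⟨ sum-cong-≋ term ⟩
    sum (λ i → f i + h i)     ≈⟨ ∑-distrib-+ f h ⟩
    sum f + sum h             ≈⟨ +-congˡ (sum-adjacent k h h-else h-pair) ⟩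
    sum f + 0#                ≈⟨ +-identityʳ _ ⟩
    det A                     ∎
    where
    D : Carrier
    D = det (minor A (suc k))
    a : Carrier
    a = A (inject₁ k) zero
    s : Fin (suc (suc n)) → Carrier
    s i = (- 1#) ^ toℕ i
    f : Fin (suc (suc n)) → Carrier
    f i = s i * (A i zero * det (minor A i))
    h : Fin (suc (suc n)) → Carrier
    h i with i Finₚ.≟ inject₁ k | i Finₚ.≟ suc k
    ... | yes _ | _     = s i * (a * (t * D))
    ... | no _  | yes _ = s i * ((t * a) * D)
    ... | no _  | no _  = 0#

    h-else : ∀ i → i ≢ inject₁ k → i ≢ suc k → h i ≈ 0#
    h-else i i≢ i≢′ with i Finₚ.≟ inject₁ k | i Finₚ.≟ suc k
    ... | yes eq | _      = contradiction eq i≢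
    ... | no _   | yes eq = contradiction eq i≢′
    ... | no _   | no _   = refl

    h-k : h (inject₁ k) ≈ s (inject₁ k) * (a * (t * D))
    h-k with inject₁ k Finₚ.≟ inject₁ k
    ... | yes _ = refl
    ... | no ne = contradiction ≡.refl ne

    h-suc : h (suc k) ≈ s (suc k) * ((t * a) * D)
    h-suc with suc k Finₚ.≟ inject₁ k | suc k Finₚ.≟ suc k
    ... | yes eq | _ = contradiction (≡.cong toℕ eq) λ eq′ →
            ℕₚ.1+n≢n (≡.trans eq′ (Finₚ.toℕ-inject₁ k))
    ... | no _ | yes _ = refl
    ... | no _ | no ne = contradiction ≡.refl ne

    h-pair : h (inject₁ k) + h (suc k) ≈ 0#
    h-pair = begin
      h (inject₁ k) + h (suc k)
        ≈⟨ +-cong h-k h-suc ⟩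
      s (inject₁ k) * (a * (t * D)) + (- 1# * (- 1#) ^ toℕ k) * ((t * a) * D)
        ≈⟨ +-congʳ (*-congʳ (reflexive (≡.cong ((- 1#) ^_) (Finₚ.toℕ-inject₁ k)))) ⟩
      (- 1#) ^ toℕ k * (a * (t * D)) + (- 1# * (- 1#) ^ toℕ k) * ((t * a) * D)
        ≈⟨ solve 5 (λ s a t d m → s :* (a :* (t :* d)) :+ (m :* s) :* ((t :* a) :* d) := (s :* (a :* (t :* d))) :+ m :* (s :* (a :* (t :* d)))) refl
             ((- 1#) ^ toℕ k) a t D (- 1#) ⟩
      (- 1#) ^ toℕ k * (a * (t * D)) + - 1# * ((- 1#) ^ toℕ k * (a * (t * D)))
        ≈⟨ +-congˡ (-1*x≈-x _) ⟩
      (- 1#) ^ toℕ k * (a * (t * D)) - (- 1#) ^ toℕ k * (a * (t * D))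
        ≈⟨ -‿inverseʳ _ ⟩
      0# ∎

    inject₁≢suc : inject₁ k ≢ suc k
    inject₁≢suc eq = ℕₚ.1+n≢n (≡.trans (≡.cong toℕ (≡.sym eq)) (Finₚ.toℕ-inject₁ k))

    minor-k : det (minor A′ (inject₁ k)) ≈ det (minor A (inject₁ k)) + t * D
    minor-k = det-linear k t (minor A (inject₁ k)) (minor A (suc k)) (minor A′ (inject₁ k))
      (λ i i≢k j → same _ (off i i≢k) (suc j))
      (λ i i≢k j → trans (same _ (off i i≢k) (suc j))
        (reflexive (≡.cong (λ q → A q (suc j)) (punch-other k i i≢k))))
      (λ j → trans (reflexive (≡.cong (λ q → A′ q (suc j)) (punch-inject₁ k)))
        (trans (add (suc j)) (sym (reflexive (≡.cong₂ (λ p q → A p (suc j) + t * A q (suc j))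
          (punch-inject₁ k) (punch-suc k))))))
      where
      off : ∀ i → i ≢ k → punchIn (inject₁ k) i ≢ suc k
      off i i≢k eq = i≢k (Finₚ.punchIn-injective (inject₁ k) i k (≡.trans eq (≡.sym (punch-inject₁ k))))

    term : ∀ i → s i * (A′ i zero * det (minor A′ i)) ≈ f i + h i
    term i with i Finₚ.≟ inject₁ k | i Finₚ.≟ suc k
    ... | yes ≡.refl | _ = begin
      s i * (A′ i zero * det (minor A′ i))
        ≈⟨ *-congˡ (*-cong (same i inject₁≢suc zero) minor-k) ⟩
      s i * (a * (det (minor A i) + t * D))
        ≈⟨ solve 4 (λ s a d e → s :* (a :* (d :+ e)) := s :* (a :* d) :+ s :* (a :* e)) refl
             (s i) a (det (minor A i)) (t * D) ⟩
      f i + s i * (a * (t * D)) ∎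
    ... | no _ | yes ≡.refl = begin
      s i * (A′ i zero * det (minor A′ i))
        ≈⟨ *-congˡ (*-cong (add zero) (det-cong λ p q → same _ (Finₚ.punchInᵢ≢i i p) (suc q))) ⟩
      s i * ((A i zero + t * a) * D)
        ≈⟨ solve 4 (λ s x y d → s :* ((x :+ y) :* d) := s :* (x :* d) :+ s :* (y :* d)) refl
             (s i) (A i zero) (t * a) D ⟩
      f i + s i * ((t * a) * D) ∎
    ... | no i≢ | no i≢′ = trans
      (*-congˡ (*-cong (same i i≢′ zero) minor-i)) (sym (+-identityʳ _))
      where
      minor-i : det (minor A′ i) ≈ det (minor A i)
      minor-i with punch-adjacent k i i≢ i≢′
      ... | k′ , eq , eq′ = det-row-add k′ t (minor A i) (minor A′ i)
        (λ p p≢ j → same _ (λ e → p≢ (Finₚ.punchIn-injective i p (suc k′) (≡.trans e (≡.sym eq)))) (suc j))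
        (λ j → trans (reflexive (≡.cong (λ q → A′ q (suc j)) eq)) (trans (add (suc j))
          (sym (reflexive (≡.cong₂ (λ p q → A p (suc j) + t * A q (suc j)) eq eq′)))))

  vandermonde : ∀ {n} → (Fin n → Carrier) → Carrier
  vandermonde y = det (λ i j → y j ^ toℕ i)

  private
    module Sweep {n} (t : Carrier) (A : Matrix (suc n) (suc n)) where

      swept : ℕ → Matrix (suc n) (suc n)
      swept m i j = if does (m ℕₚ.<? toℕ i) then A i j + t * A (Fin.pred i) j else A i j

      swept-> : ∀ {m i} → m Nat.< toℕ i → ∀ j → swept m i j ≈ A i j + t * A (Fin.pred i) j
      swept-> {m} {i} m<i j rewrite dec-true (m ℕₚ.<? toℕ i) m<i = refl

      swept-≤ : ∀ {m i} → toℕ i Nat.≤ m → ∀ j → swept m i j ≈ A i j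
      swept-≤ {m} {i} i≤m j rewrite dec-false (m ℕₚ.<? toℕ i) (ℕₚ.≤⇒≯ i≤m) = refl

      step : ∀ k → det (swept (toℕ k)) ≈ det (swept (suc (toℕ k)))
      step k = det-row-add k t (swept (suc (toℕ k))) (swept (toℕ k)) same
        (λ j → trans (swept-> (ℕₚ.≤-refl {suc (toℕ k)}) j)
          (sym (+-cong (swept-≤ {suc (toℕ k)} {suc k} ℕₚ.≤-refl j)
            (*-congˡ (swept-≤ {suc (toℕ k)} {inject₁ k}
              (ℕₚ.≤-trans (ℕₚ.≤-reflexive (Finₚ.toℕ-inject₁ k)) (ℕₚ.n≤1+n _)) j)))))
        where
        same : ∀ i → i ≢ suc k → ∀ j → swept (toℕ k) i j ≈ swept (suc (toℕ k)) i j
        same i i≢ j with toℕ k ℕₚ.<? toℕ i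
        ... | yes k<i = trans (swept-> k<i j) (sym (swept-> (ℕₚ.≤∧≢⇒< k<i (λ eq → i≢ (Finₚ.toℕ-injective (≡.sym eq)))) j))
        ... | no k≮i = trans (swept-≤ (ℕₚ.≮⇒≥ k≮i) j)
                         (sym (swept-≤ (ℕₚ.≤-trans (ℕₚ.≮⇒≥ k≮i) (ℕₚ.n≤1+n _)) j))

      chain : ∀ m → m Nat.≤ n → det (swept 0) ≈ det (swept m)
      chain zero    _   = refl
      chain (suc m) m<n = trans (chain m (ℕₚ.<⇒≤ m<n))
        (≡.subst (λ q → det (swept q) ≈ det (swept (suc q))) (Finₚ.toℕ-fromℕ< m<n) (step (fromℕ< m<n)))

      sweep : det (swept 0) ≈ det A
      sweep = trans (chain n ℕₚ.≤-refl)
        (det-cong λ i → swept-≤ (Nat.s≤s⁻¹ (Finₚ.toℕ<n i)))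

  vandermonde-suc : ∀ {n} (y : Fin (suc n) → Carrier) →
    vandermonde y ≈ prod (λ j → y (suc j) - y zero) * vandermonde (y ∘ suc)
  vandermonde-suc {n} y = begin
    det A
      ≈⟨ sweep ⟨
    1# * (1# * det (minor (swept 0) zero)) + sum (λ i → (- 1#) ^ toℕ (suc i) * (swept 0 (suc i) zero * det (minor (swept 0) (suc i))))
      ≈⟨ +-cong (trans (*-identityˡ _) (*-identityˡ _)) (sum-zero λ i →
           trans (*-congˡ (trans (*-congʳ (first i)) (zeroˡ _))) (zeroʳ _)) ⟩
    det (minor (swept 0) zero) + 0#
      ≈⟨ +-identityʳ _ ⟩
    det (minor (swept 0) zero)
      ≈⟨ det-cong (λ i j → trans (swept-> {0} {suc i} (Nat.s≤s Nat.z≤n) (suc j)) (factor i j)) ⟩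
    det (λ i j → (y (suc j) - y zero) * y (suc j) ^ toℕ i)
      ≈⟨ det-scale (λ j → y (suc j) - y zero) (λ i j → y (suc j) ^ toℕ i) ⟩
    prod (λ j → y (suc j) - y zero) * vandermonde (y ∘ suc) ∎
    where
    A : Matrix (suc n) (suc n)
    A i j = y j ^ toℕ i
    open Sweep (- y zero) A
    reduce : ∀ (i : Fin n) j → A (suc i) j + - y zero * A (inject₁ i) j ≈ (y j - y zero) * y j ^ toℕ i
    reduce i j = trans (+-congˡ (*-congˡ (reflexive (≡.cong (y j ^_) (Finₚ.toℕ-inject₁ i)))))
                       (sym (distribʳ _ _ _))
    factor : ∀ (i j : Fin n) → A (suc i) (suc j) + - y zero * A (inject₁ i) (suc j) ≈
                     (y (suc j) - y zero) * y (suc j) ^ toℕ i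
    factor i j = reduce i (suc j)
    first : ∀ i → swept 0 (suc i) zero ≈ 0#
    first i = trans (swept-> {0} {suc i} (Nat.s≤s Nat.z≤n) zero)
      (trans (reduce i zero) (trans (*-congʳ (-‿inverseʳ (y zero))) (zeroˡ _)))

  regular-prod : ∀ {n} (y : Fin n → Carrier) → (∀ j → Regular (y j)) → Regular (prod y)
  regular-prod {zero}  y reg = regular-1
  regular-prod {suc n} y reg = regular-* (reg zero) (regular-prod (y ∘ suc) (reg ∘ suc))

  vandermonde-regular : ∀ {n} (y : Fin n → Carrier) →
    (∀ {j k} → j ≢ k → Regular (y k - y j)) → Regular (vandermonde y)
  vandermonde-regular {zero}  y reg = regular-1
  vandermonde-regular {suc n} y reg = regular-≈ (sym (vandermonde-suc y))
    (regular-* (regular-prod (λ j → y (suc j) - y zero) λ j → reg {zero} {suc j} λ ())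
      (vandermonde-regular (y ∘ suc) λ j≢k → reg (j≢k ∘ Finₚ.suc-injective)))

module Coxeter where

  open Nat using (_≤_; _<_)

  Word : ℕ → Set
  Word n = List (Fin n)

  -- Here m is a Coxeter matrix, with 0 encoding ∞: the relator is then empty.
  relator : ∀ {n} → (Fin n → Fin n → ℕ) → Fin n → Fin n → Word n
  relator m i j = List.concat (List.replicate (m i j) (i ∷ j ∷ []))

  -- Since m i i = 1 gives the relator s_i s_i, generators are their own inverses
  -- and the monoid presented by these relators is the group they present.
  data Deletion {n} (m : Fin n → Fin n → ℕ) : Word n → Word n → Set where
    delete : ∀ u i j w → Deletion m (u ++ relator m i j ++ w) (u ++ w)

  record CoxeterSystem c ℓ (n : ℕ) : Set (lsuc (c ⊔ ℓ)) where
    field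
      group : Group c ℓ
    open Group group public
    field
      generator : Fin n → Carrier
      order     : Fin n → Fin n → ℕ
      diagonal  : ∀ i → order i i ≡ 1
      offDiag   : ∀ {i j} → i ≢ j → order i j ≢ 1
      symmetric : ∀ i j → order i j ≡ order j i

    eval : Word n → Carrier
    eval = List.foldr (λ i g → generator i ∙ g) ε

    field
      generates : ∀ g → ∃ λ u → eval u ≈ g
      sound     : ∀ i j → eval (relator order i j) ≈ ε
      complete  : ∀ u w → eval u ≈ eval w → EqClosure (Deletion order) u w

    HasLength : Carrier → ℕ → Set ℓ
    HasLength g l = (∃ λ u → eval u ≈ g × List.length u ≡ l) ×
                    (∀ u → eval u ≈ g → l ≤ List.length u)

    IsLongest : Carrier → ℕ → Set (c ⊔ ℓ)
    IsLongest g l = HasLength g l × (∀ h k → HasLength h k → k ≤ l)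

    _Represents_ : ∀ {N} → Vec (Fin n) N → Carrier → Set ℓ
    v Represents g = eval (Vec.toList v) ≈ g

  Finite : ∀ {c ℓ n} → CoxeterSystem c ℓ n → Set (c ⊔ ℓ)
  Finite W = ∃ λ k → Inverse (≡.setoid (Fin k)) (CoxeterSystem.setoid W)

  Irreducible : ∀ {c ℓ n} → CoxeterSystem c ℓ n → Set
  Irreducible {n = n} W = 0 < n × ∀ i j → Star (λ a b → a ≢ b × order a b ≢ 2) i j
    where open CoxeterSystem W using (order)

open import Data.Fin.Subset using (Subset; inside; outside; ∣_∣; _∈_)

module Subsets where

  open Nat using (_+_; _*_; _∸_; _≤_; _<_)

  -- The increasing enumeration of a subset.
  elements : ∀ {m} (p : Subset m) → Fin ∣ p ∣ → Fin m
  elements (inside  ∷ p) zero    = zero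
  elements (inside  ∷ p) (suc a) = suc (elements p a)
  elements (outside ∷ p) a       = suc (elements p a)

  elements-injective : ∀ {m} (p : Subset m) {a b} → elements p a ≡ elements p b → a ≡ b
  elements-injective (inside  ∷ p) {zero}  {zero}  eq = ≡.refl
  elements-injective (inside  ∷ p) {suc a} {suc b} eq =
    ≡.cong suc (elements-injective p (Finₚ.suc-injective eq))
  elements-injective (outside ∷ p) eq = elements-injective p (Finₚ.suc-injective eq)

  elements-≥ : ∀ {m} (p : Subset m) a → toℕ a ≤ toℕ (elements p a)
  elements-≥ (inside  ∷ p) zero    = Nat.z≤n
  elements-≥ (inside  ∷ p) (suc a) = Nat.s≤s (elements-≥ p a)
  elements-≥ (outside ∷ p) a       = ℕₚ.m≤n⇒m≤1+n (elements-≥ p a)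

  gap : ∀ {m} (p : Subset m) → Fin ∣ p ∣ → ℕ
  gap p a = toℕ (elements p a) ∸ toℕ a

  gap-monotone : ∀ {m} (p : Subset m) {a b} → a Fin.≤ b → gap p a ≤ gap p b
  gap-monotone (inside  ∷ p) {zero}          a≤b = Nat.z≤n
  gap-monotone (inside  ∷ p) {suc a} {suc b} a≤b = gap-monotone p (Nat.s≤s⁻¹ a≤b)
  gap-monotone (outside ∷ p) {a}     {b}     a≤b = ≡.subst₂ _≤_
    (≡.sym (ℕₚ.+-∸-assoc 1 (elements-≥ p a))) (≡.sym (ℕₚ.+-∸-assoc 1 (elements-≥ p b)))
    (Nat.s≤s (gap-monotone p a≤b))

  allSubsets : ∀ m → List (Subset m)
  allSubsets zero    = [] ∷ []
  allSubsets (suc m) = List.map (outside ∷_) (allSubsets m) ++ List.map (inside ∷_) (allSubsets m)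

  -- Subsets of S × {0, …, ν - 1} are subsets of Fin (n * ν), where
  -- combine i k is the position of (s_i , k) in lexicographic order.
  fibre : ∀ {n ν} → Subset (n * ν) → Fin n → Subset ν
  fibre z i = Vec.tabulate λ k → Vec.lookup z (Fin.combine i k)

  sumℕ : ∀ {n} → (Fin n → ℕ) → ℕ
  sumℕ = sum where open import Algebra.Properties.Monoid.Sum ℕₚ.+-0-monoid

  size-++ : ∀ m {k} (f : Fin (m + k) → Bool) →
            ∣ Vec.tabulate f ∣ ≡
            ∣ Vec.tabulate (f ∘ (Fin._↑ˡ k)) ∣ + ∣ Vec.tabulate (f ∘ (m Fin.↑ʳ_)) ∣
  size-++ zero    f = ≡.refl
  size-++ (suc m) f with f zero
  ... | inside  = ≡.cong suc (size-++ m (f ∘ suc))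
  ... | outside = size-++ m (f ∘ suc)

  size-combine : ∀ n {ν} (f : Fin (n * ν) → Bool) →
                 ∣ Vec.tabulate f ∣ ≡ sumℕ (λ i → ∣ Vec.tabulate (λ k → f (Fin.combine {n} i k)) ∣)
  size-combine zero        f = ≡.refl
  size-combine (suc n) {ν} f = ≡.trans (size-++ ν f)
    (≡.cong (∣ Vec.tabulate (f ∘ (Fin._↑ˡ (n * ν))) ∣ +_) (size-combine n (f ∘ (ν Fin.↑ʳ_))))

  size-fibres : ∀ {n ν} (z : Subset (n * ν)) → ∣ z ∣ ≡ sumℕ (λ i → ∣ fibre {n} z i ∣)
  size-fibres {n} z = ≡.trans (≡.cong ∣_∣ (≡.sym (Vecₚ.tabulate∘lookup z))) (size-combine n (Vec.lookup z))

module Words where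

  open Nat using (_+_; _*_; _≤_; _<_)
  open Subsets

  positions : ∀ {n N} → Vec (Fin n) N → Fin n → Subset N
  positions v i = Vec.tabulate λ j → does (Vec.lookup v j Finₚ.≟ i)

  abelianVector : ∀ {n N} → Vec (Fin n) N → Fin n → ℕ
  abelianVector v i = ∣ positions v i ∣

  IsMaxOccurrences : ∀ {c ℓ n} (W : Coxeter.CoxeterSystem c ℓ n) →
                     Coxeter.CoxeterSystem.Carrier W → ℕ → ℕ → Set ℓ
  IsMaxOccurrences {n = n} W g N ν =
    (∃ λ (v : Vec (Fin n) N) → v Represents g × ∃ λ i → abelianVector v i ≡ ν) ×
    (∀ (v : Vec (Fin n) N) → v Represents g → ∀ i → abelianVector v i ≤ ν)
    where open Coxeter.CoxeterSystem W using (_Represents_)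

  pairs : ∀ N → List (Fin N × Fin N)
  pairs N = List.cartesianProduct (List.allFin N) (List.allFin N)

  inv : ∀ {n N} → Vec (Fin n) N → ℕ
  inv {N = N} v = List.length (List.filter
    (λ (a , b) → (a Finₚ.<? b) ×-dec (Vec.lookup v b Finₚ.<? Vec.lookup v a)) (pairs N))

  record OrderedSetPartition (n N : ℕ) : Set where
    field
      part   : Fin n → Subset N
      unique : ∀ j → ∃! _≡_ λ i → j ∈ part i

  Ω : ∀ {n N} → Vec (Fin n) N → OrderedSetPartition n N
  Ω v = record
    { part   = positions v
    ; unique = λ j → Vec.lookup v j
        , Vecₚ.lookup⇒[]= j _ (≡.trans (Vecₚ.lookup∘tabulate _ j) (dec-true (Vec.lookup v j Finₚ.≟ Vec.lookup v j) ≡.refl))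
        , λ {i} j∈ → decide (≡.trans (≡.sym (Vecₚ.lookup∘tabulate (λ j → does (Vec.lookup v j Finₚ.≟ i)) j))
                               (Vecₚ.[]=⇒lookup j∈))
    }
    where
    decide : ∀ {n} {a b : Fin n} → does (a Finₚ.≟ b) ≡ true → a ≡ b
    decide {a = a} {b} eq with a Finₚ.≟ b
    ... | yes a≡b = a≡b

  IndexSet : ∀ {n} → ℕ → (Fin n → ℕ) → Set
  IndexSet {n} ν α = ∃ λ (z : Subset (n * ν)) → ∀ i → ∣ fibre {n} z i ∣ ≡ α i

  indexSets : ∀ {n} ν (α : Fin n → ℕ) → List (IndexSet ν α)
  indexSets {n} ν α = List.mapMaybe
    (λ z → Maybe.map (z ,_) (dec⇒maybe (Finₚ.all? λ i → ∣ fibre {n} z i ∣ ℕₚ.≟ α i)))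
    (allSubsets (n * ν))

  private
    open import Algebra.Properties.CommutativeMonoid.Sum ℕₚ.+-0-commutativeMonoid
      using (sum; sum-cong-≗; ∑-distrib-+; sum-replicate-zero)

    indicator : Bool → ℕ
    indicator b = if b then 1 else 0

    sum-indicator : ∀ {n} (x : Fin n) → sum (λ i → indicator (does (x Finₚ.≟ i))) ≡ 1
    sum-indicator {suc n} zero    = ≡.cong suc (sum-replicate-zero n)
    sum-indicator {suc n} (suc x) = sum-indicator x

    size-∷ : ∀ {m} b (p : Subset m) → ∣ b ∷ p ∣ ≡ indicator b + ∣ p ∣
    size-∷ inside  p = ≡.refl
    size-∷ outside p = ≡.refl

  sum-abelianVector : ∀ {n N} (v : Vec (Fin n) N) → sumℕ (abelianVector v) ≡ N
  sum-abelianVector {n} []      = sum-replicate-zero n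
  sum-abelianVector {n} (x ∷ v) = ≡.trans
    (sum-cong-≗ λ i → size-∷ (does (x Finₚ.≟ i)) (positions v i))
    (≡.trans (∑-distrib-+ (λ i → indicator (does (x Finₚ.≟ i))) (abelianVector v))
      (≡.cong₂ _+_ (sum-indicator x) (sum-abelianVector v)))

  size-indexSet : ∀ {n N ν} (v : Vec (Fin n) N) (z : IndexSet ν (abelianVector v)) → N ≡ ∣ proj₁ z ∣
  size-indexSet {n} v (z , fibres) = ≡.sym (≡.trans (size-fibres {n} z)
    (≡.trans (sum-cong-≗ fibres) (sum-abelianVector v)))

module Partitions where

  open Nat using (_∸_; _≤_)
  open Subsets
  open Words

  record Partition (d : ℕ) : Set where
    field
      parts      : Fin d → ℕ
      decreasing : ∀ {j k} → j Fin.≤ k → parts k ≤ parts j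

  -- With 0-based j the j-th largest element is elements p (opposite j),
  -- and the amount ∣ p ∣ - (j + 1) to subtract from it is opposite j.
  gapPartition : ∀ {m} (p : Subset m) → Partition ∣ p ∣
  gapPartition p = record
    { parts      = λ j → toℕ (elements p (Fin.opposite j)) ∸ toℕ (Fin.opposite j)
    ; decreasing = λ {j} {k} j≤k → gap-monotone p (≡.subst₂ _≤_
        (≡.sym (Finₚ.opposite-prop k)) (≡.sym (Finₚ.opposite-prop j))
        (ℕₚ.∸-monoʳ-≤ ∣ p ∣ (Nat.s≤s j≤k)))
    }

  standardPartitions : ∀ {n N ν} (v : Vec (Fin n) N) → IndexSet ν (abelianVector v) →
                       ∀ i → Partition ∣ positions v i ∣
  standardPartitions v (z , fibres) i = ≡.subst Partition (fibres i) (gapPartition (fibre z i))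

module Model {c ℓ} (R : CommutativeRing c ℓ) where

  open Nat using (_+_; _*_)
  open Subsets
  open Words
  open Partitions

  polynomials : ℕ → CommutativeRing c ℓ
  polynomials N = Polynomials.polynomialRing R N

  rationalFunctions : ℕ → CommutativeRing (c ⊔ ℓ) ℓ
  rationalFunctions N = Fractions.fractionRing (polynomials N)

  Poly : ℕ → Set c
  Poly N = CommutativeRing.Carrier (polynomials N)

  RatFun : ℕ → Set (c ⊔ ℓ)
  RatFun N = CommutativeRing.Carrier (rationalFunctions N)

  infix  4 _≈ᶠ_
  infixl 7 _*ᶠ_

  _≈ᶠ_ : ∀ {N} → RatFun N → RatFun N → Set ℓ
  _≈ᶠ_ {N} = CommutativeRing._≈_ (rationalFunctions N)

  _*ᶠ_ : ∀ {N} → RatFun N → RatFun N → RatFun N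
  _*ᶠ_ {N} = CommutativeRing._*_ (rationalFunctions N)

  det : ∀ {m} → (Fin m → Fin m → CommutativeRing.Carrier R) → CommutativeRing.Carrier R
  det = Determinants.det R

  detᵖ : ∀ {N m} → (Fin m → Fin m → Poly N) → Poly N
  detᵖ {N} = Determinants.det (polynomials N)

  embed : ∀ {N} → Poly N → RatFun N
  embed {N} = Fractions.embed (polynomials N)

  const : ∀ {N} → CommutativeRing.Carrier R → Poly N
  const {N} = Polynomials.const R N

  x : ∀ {N} → Fin N → Poly N
  x {N} = Polynomials.var R N

  ParameterTensor : ℕ → ℕ → ℕ → Set c
  ParameterTensor N n ν = Fin N → Fin n → Fin ν → CommutativeRing.Carrier R

  module _ {N : ℕ} where

    open CommutativeRing (polynomials N) using (1#; -_; _-_) renaming (_*_ to _·_)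
    open import Algebra.Properties.Semiring.Exp (CommutativeRing.semiring (polynomials N)) using (_^_)
    open import Algebra.Properties.Semiring.Sum (CommutativeRing.semiring (polynomials N)) using (sum)
    open Determinants (polynomials N) using (vandermonde; vandermonde-regular)

    σ : ∀ {n} → Vec (Fin n) N → Poly N
    σ v = (- 1#) ^ inv v

    product : ∀ {a} {A : Set a} → List A → (A → Poly N) → Poly N
    product xs f = List.foldr (λ a p → f a · p) 1# xs

    𝒱 : ∀ {n} → Vec (Fin n) N → Poly N
    𝒱 {n} v =
      product (List.filter (λ i → 2 ℕₚ.≤? abelianVector v i) (List.allFin n)) λ i →
      product (List.filter (λ (j , k) → (j Finₚ.<? k) ×-dec
                              ((Vec.lookup v j Finₚ.≟ i) ×-dec (Vec.lookup v k Finₚ.≟ i))) (pairs N))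
        λ (j , k) → x k - x j

    modelMatrix : ∀ {n ν} → Vec (Fin n) N → ParameterTensor N n ν → Fin N → Fin N → Poly N
    modelMatrix v P i l = sum λ k → const (P i (Vec.lookup v l) k) · x l ^ toℕ k

    -- The exponent i - 1 + λ_{d-i+1} of 1-based row i is toℕ i + λ (opposite i)
    -- for 0-based i.
    schur : (J : Subset N) → Partition ∣ J ∣ → RatFun N
    schur J partition = Fractions.fraction
      (detᵖ λ i j → x (elements J j) ^ (toℕ i + parts (Fin.opposite i)))
      (vandermonde λ j → x (elements J j))
      (vandermonde-regular (λ j → x (elements J j)) λ j≢k →
        Polynomials.var-var-regular R N (j≢k ∘ elements-injective J))
      where open Partition partition

    open import Algebra.Properties.CommutativeMonoid.Sum
      (CommutativeRing.*-commutativeMonoid (rationalFunctions N)) using () renaming (sum to prodᶠ)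

    partialSchur : ∀ {n} (P : OrderedSetPartition n N) →
                   (∀ i → Partition ∣ OrderedSetPartition.part P i ∣) → RatFun N
    partialSchur P Λ = prodᶠ λ i → schur (OrderedSetPartition.part P i) (Λ i)

    sumOver : ∀ {a} {A : Set a} → List A → (A → RatFun N) → RatFun N
    sumOver xs f = List.foldr (λ a r → f a +ᶠ r) (CommutativeRing.0# (rationalFunctions N)) xs
      where open CommutativeRing (rationalFunctions N) using () renaming (_+_ to _+ᶠ_)

  flatten : ∀ {N n ν} → ParameterTensor N n ν →
            Fin N → Fin (n * ν) → CommutativeRing.Carrier R
  flatten {ν = ν} P i = uncurry (P i) ∘ Fin.remQuot ν

  submatrix : ∀ {N n ν} → ParameterTensor N n ν → (v : Vec (Fin n) N) →
              IndexSet ν (abelianVector v) → Fin N → Fin N → CommutativeRing.Carrier R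
  submatrix P v z i l = flatten P i (elements (proj₁ z) (Fin.cast (size-indexSet v z) l))

open Coxeter public
open Words public
open Partitions public
open Reals using (ℝ) public

{-# OPTIONS --safe #-}

-- The columns of M(v, P) are the images, under the linear map with matrix P, of the
-- vectors in R^(nν) that carry (1, x_l, …, x_l^(ν-1)) in block v_l and 0 elsewhere. Working
-- in the exterior algebra, functoriality (Cauchy–Binet) writes det M(v, P) as the sum over
-- 𝔷 of det [P]_𝔷 times the 𝔷-coordinate of the wedge of these vectors. Sorting the wedge
-- by blocks costs the sign σ(v) and leaves a product of generalised Vandermonde
-- determinants, one for each letter; it vanishes unless 𝔷 ∈ ℨ_α. Dividing each factor by
-- the ordinary Vandermonde determinant gives the Schur functions, and the product of the
-- latter determinants is 𝒱(v).
module Submission where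

open import Defs
open import Algebra.Bundles using (CommutativeMonoid; CommutativeRing)
open import Algebra.Morphism.Structures using (IsRingHomomorphism)
open import Data.Bool.Base using (Bool; true; false; if_then_else_; _∧_)
open import Data.Fin.Base as Fin using (Fin; zero; suc; toℕ; punchIn)
import Data.Fin.Properties as Finₚ
open import Data.Fin.Subset using (Subset; inside; outside; ∣_∣; ⊤)
open import Data.Fin.Subset.Properties using (∣⊤∣≡n)
open import Data.List.Base as List using (List; []; _∷_; _++_)
import Data.Maybe.Base as Maybe
open import Data.Nat.Base as Nat using (ℕ; zero; suc)
import Data.Nat.Properties as ℕₚ
open import Data.Product using (∃; _×_; _,_; proj₁; proj₂; uncurry)
open import Data.Sum.Base using ([_,_])
open import Data.Vec.Base as Vec using (Vec; []; _∷_)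
import Data.Vec.Properties as Vecₚ
open import Function.Base using (_∘_; id)
open import Relation.Binary.PropositionalEquality as ≡ using (_≡_; _≢_)
open import Relation.Nullary.Decidable
  using (Dec; yes; no; does; dec-true; dec-false; dec⇒maybe; _×-dec_)
open import Relation.Nullary.Negation using (¬_; contradiction)
open import Relation.Unary using (Decidable)

-- Determinants are given by Laplace expansion, so there are no permutations to work with.
-- Everything rests instead on one operation, left multiplication by a vector, acting on coordinate
-- functions by recursion on the subset. Iterated, it reproduces Laplace expansion along the first
-- column; its linearity, anticommutativity and vanishing on a repeated vector yield functoriality.
-- The terms outside ℨ_α vanish by degree: after sorting, the factor of the letter s_i is
-- homogeneous of degree c_i, and some fibre of 𝔷 has another size. Fractions enter only at the very
-- end. Until then all identities hold in the polynomial ring, and a Schur function is used only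
-- through the relation: denominator times quotient equals numerator.

-- Sums and products over lists.

module ListSum {c ℓ} (M : CommutativeMonoid c ℓ) where

  open CommutativeMonoid M
  open import Algebra.Properties.CommutativeMonoid.Sum M using (sum; sum-cong-≋)

  -- Stated for a monoid because it serves twice: additively it unfolds to the same fold as
  -- `sumOver`, multiplicatively to the same fold as `product`.
  ∑ : ∀ {a} {A : Set a} → List A → (A → Carrier) → Carrier
  ∑ xs f = List.foldr (λ a r → f a ∙ r) ε xs

  ∑-cong : ∀ {a} {A : Set a} (xs : List A) {f g : A → Carrier} →
           (∀ a → f a ≈ g a) → ∑ xs f ≈ ∑ xs g
  ∑-cong []       f≈g = refl
  ∑-cong (x ∷ xs) f≈g = ∙-cong (f≈g x) (∑-cong xs f≈g)

  ∑-++ : ∀ {a} {A : Set a} (xs ys : List A) f → ∑ (xs ++ ys) f ≈ ∑ xs f ∙ ∑ ys f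
  ∑-++ []       ys f = sym (identityˡ _)
  ∑-++ (x ∷ xs) ys f = trans (∙-congˡ (∑-++ xs ys f)) (sym (assoc _ _ _))

  ∑-map : ∀ {a b} {A : Set a} {B : Set b} (h : A → B) xs f → ∑ (List.map h xs) f ≈ ∑ xs (f ∘ h)
  ∑-map h []       f = refl
  ∑-map h (x ∷ xs) f = ∙-congˡ (∑-map h xs f)

  ∑-filter : ∀ {a p} {A : Set a} {P : A → Set p} (P? : Decidable P) xs f →
             ∑ (List.filter P? xs) f ≈ ∑ xs λ a → if does (P? a) then f a else ε
  ∑-filter P? []       f = refl
  ∑-filter P? (x ∷ xs) f with does (P? x)
  ... | true  = ∙-congˡ (∑-filter P? xs f)
  ... | false = trans (∑-filter P? xs f) (sym (identityˡ _))

  ∑-cartesianProduct : ∀ {a b} {A : Set a} {B : Set b} (xs : List A) (ys : List B) f →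
    ∑ (List.cartesianProduct xs ys) f ≈ ∑ xs λ a → ∑ ys λ b → f (a , b)
  ∑-cartesianProduct []       ys f = refl
  ∑-cartesianProduct (x ∷ xs) ys f = trans
    (∑-++ (List.map (x ,_) ys) (List.cartesianProduct xs ys) f)
    (∙-cong (∑-map (x ,_) ys f) (∑-cartesianProduct xs ys f))

  ∑-tabulate : ∀ {a} {A : Set a} {n} (h : Fin n → A) f → ∑ (List.tabulate h) f ≈ sum (f ∘ h)
  ∑-tabulate {n = zero}  h f = refl
  ∑-tabulate {n = suc n} h f = ∙-congˡ (∑-tabulate (h ∘ suc) f)

  ∑-filter-pairs : ∀ {p N} {P : Fin N × Fin N → Set p} (P? : Decidable P) f →
    ∑ (List.filter P? (pairs N)) f ≈
    sum λ a → sum λ b → if does (P? (a , b)) then f (a , b) else ε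
  ∑-filter-pairs {N = N} P? f = trans (∑-filter P? (pairs N) f)
    (trans (∑-cartesianProduct (List.allFin N) (List.allFin N) g)
      (trans (∑-cong (List.allFin N) (λ a → ∑-tabulate id (λ b → g (a , b))))
        (∑-tabulate id (λ a → sum λ b → g (a , b)))))
    where
    g : Fin N × Fin N → Carrier
    g ab = if does (P? ab) then f ab else ε

  -- Made for terms restricted to a < b: no such pair has second member `zero`. Splitting off the
  -- pairs with first member `zero` allows induction on the length of the word.
  sum-pairs-suc : ∀ {N} (f : Fin (suc N) → Fin (suc N) → Carrier) → (∀ a → f a zero ≈ ε) →
    sum (λ a → sum (f a)) ≈ sum (λ b → f zero (suc b)) ∙ sum λ a → sum λ b → f (suc a) (suc b)
  sum-pairs-suc f f₀≈ε = ∙-cong (drop zero) (sum-cong-≋ (drop ∘ suc))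
    where
    drop : ∀ a → sum (f a) ≈ sum (λ b → f a (suc b))
    drop a = trans (∙-congʳ (f₀≈ε a)) (identityˡ _)

-- Exterior algebra in coordinates, up to the Cauchy-Binet formula.

module Exterior {c ℓ} (R : CommutativeRing c ℓ) where

  open CommutativeRing R hiding (zero)
  open import Algebra.Properties.Ring ring using (-1*x≈-x; -‿involutive)
  open import Algebra.Properties.Semiring.Exp semiring using (_^_)
  open import Algebra.Properties.Semiring.Sum semiring using (sum; sum-cong-≋; *-distribˡ-sum)
  open import Algebra.Solver.Ring.NaturalCoefficients.Default commutativeSemiring
    using (solve; _:=_; _:+_; _:*_)
  open import Relation.Binary.Reasoning.Setoid setoid
  open Determinants R using (det; det-cong)
  open ListSum +-commutativeMonoid using (∑; ∑-++; ∑-map)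
  open Subsets

  -- The coordinates, in the basis e_z, of an element of the exterior algebra of R^m.
  Form : ℕ → Set c
  Form m = Subset m → Carrier

  -- Signs are written as multiplication by this element, so that the semiring solver can treat it
  -- as one more variable.
  ε : Carrier
  ε = - 1#

  ε*ε≈1 : ε * ε ≈ 1#
  ε*ε≈1 = trans (-1*x≈-x (- 1#)) (-‿involutive 1#)

  -- With b = b₀ e₀ + b′ and f = fₒ + e₀ ∧ fᵢ, this is b ∧ f = b′ ∧ fₒ + e₀ ∧ (b₀ fₒ - b′ ∧ fᵢ); the
  -- sign comes from moving b′ past e₀.
  wedge : ∀ {m} → (Fin m → Carrier) → Form m → Form m
  wedge b f []            = 0#
  wedge b f (outside ∷ z) = wedge (b ∘ suc) (f ∘ (outside ∷_)) z
  wedge b f (inside  ∷ z) =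
    b zero * f (outside ∷ z) + ε * wedge (b ∘ suc) (f ∘ (inside ∷_)) z

  wedge-cong : ∀ {m} {a b : Fin m → Carrier} {f g : Form m} →
               (∀ k → a k ≈ b k) → (∀ z → f z ≈ g z) → ∀ z → wedge a f z ≈ wedge b g z
  wedge-cong a≈b f≈g []            = refl
  wedge-cong a≈b f≈g (outside ∷ z) = wedge-cong (a≈b ∘ suc) (f≈g ∘ (outside ∷_)) z
  wedge-cong a≈b f≈g (inside  ∷ z) = +-cong (*-cong (a≈b zero) (f≈g (outside ∷ z)))
    (*-congˡ (wedge-cong (a≈b ∘ suc) (f≈g ∘ (inside ∷_)) z))

  wedge-congʳ : ∀ {m} (b : Fin m → Carrier) {f g : Form m} →
                (∀ z → f z ≈ g z) → ∀ z → wedge b f z ≈ wedge b g z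
  wedge-congʳ b = wedge-cong {a = b} (λ _ → refl)

  -- One induction for scaling and addition together; `wedge-scale` and `wedge-+` are its
  -- specialisations.
  wedge-linear : ∀ {m} (b : Fin m → Carrier) t (f g : Form m) z →
                 wedge b (λ y → t * f y + g y) z ≈ t * wedge b f z + wedge b g z
  wedge-linear b t f g []            = sym (trans (+-identityʳ _) (zeroʳ t))
  wedge-linear b t f g (outside ∷ z) =
    wedge-linear (b ∘ suc) t (f ∘ (outside ∷_)) (g ∘ (outside ∷_)) z
  wedge-linear b t f g (inside  ∷ z) = trans
    (+-congˡ (*-congˡ (wedge-linear (b ∘ suc) t (f ∘ (inside ∷_)) (g ∘ (inside ∷_)) z)))
    (solve 7 (λ b e t p q v w →
        b :* (t :* p :+ q) :+ e :* (t :* v :+ w) := t :* (b :* p :+ e :* v) :+ (b :* q :+ e :* w)) refl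
      (b zero) ε t (f (outside ∷ z)) (g (outside ∷ z))
      (wedge (b ∘ suc) (f ∘ (inside ∷_)) z) (wedge (b ∘ suc) (g ∘ (inside ∷_)) z))

  wedge-zeroʳ : ∀ {m} (b : Fin m → Carrier) z → wedge b (λ _ → 0#) z ≈ 0#
  wedge-zeroʳ b []            = refl
  wedge-zeroʳ b (outside ∷ z) = wedge-zeroʳ (b ∘ suc) z
  wedge-zeroʳ b (inside  ∷ z) = trans
    (+-cong (zeroʳ (b zero)) (trans (*-congˡ (wedge-zeroʳ (b ∘ suc) z)) (zeroʳ ε))) (+-identityˡ 0#)

  wedge-scale : ∀ {m} (b : Fin m → Carrier) t (f : Form m) z →
                wedge b (λ y → t * f y) z ≈ t * wedge b f z
  wedge-scale b t f z = begin
    wedge b (λ y → t * f y) z               ≈⟨ wedge-congʳ b (λ y → sym (+-identityʳ (t * f y))) z ⟩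
    wedge b (λ y → t * f y + 0#) z          ≈⟨ wedge-linear b t f (λ _ → 0#) z ⟩
    t * wedge b f z + wedge b (λ _ → 0#) z  ≈⟨ +-congˡ (wedge-zeroʳ b z) ⟩
    t * wedge b f z + 0#                    ≈⟨ +-identityʳ _ ⟩
    t * wedge b f z                         ∎

  wedge-+ : ∀ {m} (b : Fin m → Carrier) (f g : Form m) z →
            wedge b (λ y → f y + g y) z ≈ wedge b f z + wedge b g z
  wedge-+ b f g z = begin
    wedge b (λ y → f y + g y) z       ≈⟨ wedge-congʳ b (λ y → +-congʳ (sym (*-identityˡ (f y)))) z ⟩
    wedge b (λ y → 1# * f y + g y) z  ≈⟨ wedge-linear b 1# f g z ⟩
    1# * wedge b f z + wedge b g z    ≈⟨ +-congʳ (*-identityˡ _) ⟩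
    wedge b f z + wedge b g z         ∎

  wedge-linearˡ : ∀ {m} t (a b : Fin m → Carrier) (f : Form m) z →
                  wedge (λ k → t * a k + b k) f z ≈ t * wedge a f z + wedge b f z
  wedge-linearˡ t a b f []            = sym (trans (+-identityʳ _) (zeroʳ t))
  wedge-linearˡ t a b f (outside ∷ z) = wedge-linearˡ t (a ∘ suc) (b ∘ suc) (f ∘ (outside ∷_)) z
  wedge-linearˡ t a b f (inside  ∷ z) = trans
    (+-congˡ (*-congˡ (wedge-linearˡ t (a ∘ suc) (b ∘ suc) (f ∘ (inside ∷_)) z)))
    (solve 7 (λ a b e t p v w →
        (t :* a :+ b) :* p :+ e :* (t :* v :+ w) := t :* (a :* p :+ e :* v) :+ (b :* p :+ e :* w)) refl
      (a zero) (b zero) ε t (f (outside ∷ z))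
      (wedge (a ∘ suc) (f ∘ (inside ∷_)) z) (wedge (b ∘ suc) (f ∘ (inside ∷_)) z))

  wedge-zeroˡ : ∀ {m} {b : Fin m → Carrier} → (∀ k → b k ≈ 0#) → ∀ f z → wedge b f z ≈ 0#
  wedge-zeroˡ b≈0 f []            = refl
  wedge-zeroˡ b≈0 f (outside ∷ z) = wedge-zeroˡ (b≈0 ∘ suc) (f ∘ (outside ∷_)) z
  wedge-zeroˡ b≈0 f (inside  ∷ z) = trans
    (+-cong (trans (*-congʳ (b≈0 zero)) (zeroˡ _))
      (trans (*-congˡ (wedge-zeroˡ (b≈0 ∘ suc) (f ∘ (inside ∷_)) z)) (zeroʳ ε)))
    (+-identityˡ 0#)

  wedge-wedge : ∀ {m} (a b : Fin (suc m) → Carrier) (f : Form (suc m)) z →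
    wedge a (wedge b f) (inside ∷ z) ≈
    a zero * wedge (b ∘ suc) (f ∘ (outside ∷_)) z +
    ε * (b zero * wedge (a ∘ suc) (f ∘ (outside ∷_)) z +
         ε * wedge (a ∘ suc) (wedge (b ∘ suc) (f ∘ (inside ∷_))) z)
  wedge-wedge a b f z = +-congˡ (*-congˡ (trans
    (wedge-linear (a ∘ suc) (b zero) (f ∘ (outside ∷_))
      (λ y → ε * wedge (b ∘ suc) (f ∘ (inside ∷_)) y) z)
    (+-congˡ (wedge-scale (a ∘ suc) ε (wedge (b ∘ suc) (f ∘ (inside ∷_))) z))))

  wedge-anticomm : ∀ {m} (a b : Fin m → Carrier) (f : Form m) z →
                   wedge a (wedge b f) z ≈ ε * wedge b (wedge a f) z
  wedge-anticomm a b f []            = sym (zeroʳ ε)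
  wedge-anticomm a b f (outside ∷ z) = wedge-anticomm (a ∘ suc) (b ∘ suc) (f ∘ (outside ∷_)) z
  wedge-anticomm a b f (inside  ∷ z) = begin
    wedge a (wedge b f) (inside ∷ z)
      ≈⟨ wedge-wedge a b f z ⟩
    a zero * B + ε * (b zero * A + ε * wedge (a ∘ suc) (wedge (b ∘ suc) (f ∘ (inside ∷_))) z)
      -- The solver does not know that `ε * ε` is 1, so the first summand is given this factor by
      -- hand.
      ≈⟨ +-cong (trans (sym (*-identityˡ _)) (*-congʳ (sym ε*ε≈1)))
           (*-congˡ (+-congˡ (*-congˡ (wedge-anticomm (a ∘ suc) (b ∘ suc) (f ∘ (inside ∷_)) z)))) ⟩
    ε * ε * (a zero * B) + ε * (b zero * A + ε * (ε * BA))
      ≈⟨ solve 6 (λ e a b A B BA →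
           e :* e :* (a :* B) :+ e :* (b :* A :+ e :* (e :* BA)) :=
           e :* (b :* A :+ e :* (a :* B :+ e :* BA))) refl ε (a zero) (b zero) A B BA ⟩
    ε * (b zero * A + ε * (a zero * B + ε * BA))
      ≈⟨ *-congˡ (wedge-wedge b a f z) ⟨
    ε * wedge b (wedge a f) (inside ∷ z) ∎
    where
    A B BA : Carrier
    A = wedge (a ∘ suc) (f ∘ (outside ∷_)) z
    B = wedge (b ∘ suc) (f ∘ (outside ∷_)) z
    BA = wedge (b ∘ suc) (wedge (a ∘ suc) (f ∘ (inside ∷_))) z

  -- Anticommutativity would only show that twice this coordinate is zero, and 2 may be a zero
  -- divisor in `R`; hence a separate induction, in which the two mixed terms cancel.
  wedge-self : ∀ {m} (a : Fin m → Carrier) (f : Form m) z → wedge a (wedge a f) z ≈ 0#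
  wedge-self a f []            = refl
  wedge-self a f (outside ∷ z) = wedge-self (a ∘ suc) (f ∘ (outside ∷_)) z
  wedge-self a f (inside  ∷ z) = begin
    wedge a (wedge a f) (inside ∷ z)
      ≈⟨ wedge-wedge a a f z ⟩
    x + ε * (x + ε * wedge (a ∘ suc) (wedge (a ∘ suc) (f ∘ (inside ∷_))) z)
      ≈⟨ +-congˡ (*-congˡ (trans
           (+-congˡ (trans (*-congˡ (wedge-self (a ∘ suc) (f ∘ (inside ∷_)) z)) (zeroʳ ε)))
           (+-identityʳ x))) ⟩
    x + ε * x
      ≈⟨ +-congˡ (-1*x≈-x x) ⟩
    x - x
      ≈⟨ -‿inverseʳ x ⟩
    0# ∎
    where
    x : Carrier
    x = a zero * wedge (a ∘ suc) (f ∘ (outside ∷_)) z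

  unit : ∀ {m} → Form m
  unit []            = 1#
  unit (outside ∷ z) = unit z
  unit (inside  ∷ z) = 0#

  wedges : ∀ {N m} → (Fin N → Fin m → Carrier) → Form m
  wedges {zero}  B = unit
  wedges {suc N} B = wedge (B zero) (wedges (B ∘ suc))

  wedges-cong : ∀ {N m} {A B : Fin N → Fin m → Carrier} → (∀ l k → A l k ≈ B l k) →
                ∀ z → wedges A z ≈ wedges B z
  wedges-cong {zero}  A≈B z = refl
  wedges-cong {suc N} A≈B = wedge-cong (A≈B zero) (wedges-cong (A≈B ∘ suc))

  -- Q is kept general because the inductive step replaces it by Q ∘ suc.
  wedge-vanish : ∀ {m q} (Q : ℕ → Set q) (b : Fin m → Carrier) (f : Form m) →
                 (∀ y → Q (suc ∣ y ∣) → f y ≈ 0#) → ∀ z → Q ∣ z ∣ → wedge b f z ≈ 0#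
  wedge-vanish Q b f f≈0 []            q = refl
  wedge-vanish Q b f f≈0 (outside ∷ z) q =
    wedge-vanish Q (b ∘ suc) (f ∘ (outside ∷_)) (f≈0 ∘ (outside ∷_)) z q
  wedge-vanish Q b f f≈0 (inside  ∷ z) q = trans
    (+-cong (trans (*-congˡ (f≈0 (outside ∷ z) q)) (zeroʳ _))
      (trans
        (*-congˡ (wedge-vanish (Q ∘ suc) (b ∘ suc) (f ∘ (inside ∷_)) (f≈0 ∘ (inside ∷_)) z q))
        (zeroʳ ε)))
    (+-identityˡ 0#)

  wedges-homogeneous : ∀ {N m} (B : Fin N → Fin m → Carrier) z → ∣ z ∣ ≢ N → wedges B z ≈ 0#
  wedges-homogeneous {zero}  B []            z≢ = contradiction ≡.refl z≢
  wedges-homogeneous {zero}  B (outside ∷ z) z≢ = wedges-homogeneous {zero} (λ ()) z z≢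
  wedges-homogeneous {zero}  B (inside  ∷ z) z≢ = refl
  wedges-homogeneous {suc N} B z z≢ = wedge-vanish (_≢ suc N) (B zero) (wedges (B ∘ suc))
    (λ y y≢ → wedges-homogeneous (B ∘ suc) y (y≢ ∘ ≡.cong suc)) z z≢

  remove : ∀ {m} (z : Subset m) → Fin ∣ z ∣ → Subset m
  remove (outside ∷ z) a       = outside ∷ remove z a
  remove (inside  ∷ z) zero    = outside ∷ z
  remove (inside  ∷ z) (suc a) = inside ∷ remove z a

  ∣remove∣ : ∀ {m} (z : Subset m) a → suc ∣ remove z a ∣ ≡ ∣ z ∣
  ∣remove∣ (outside ∷ z) a       = ∣remove∣ z a
  ∣remove∣ (inside  ∷ z) zero    = ≡.refl
  ∣remove∣ (inside  ∷ z) (suc a) = ≡.cong suc (∣remove∣ z a)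

  -- Identifies deletion of an element of the subset with deletion of a row in `minor`.
  elements-remove : ∀ {m n} (z : Subset m) .(eq : suc n ≡ ∣ z ∣) (a : Fin (suc n))
    .(eq′ : n ≡ ∣ remove z (Fin.cast eq a) ∣) i →
    elements (remove z (Fin.cast eq a)) (Fin.cast eq′ i) ≡ elements z (Fin.cast eq (punchIn a i))
  elements-remove (outside ∷ z) eq a eq′ i = ≡.cong suc (elements-remove z eq a eq′ i)
  elements-remove (inside  ∷ z) eq zero    eq′ i       = ≡.refl
  elements-remove (inside  ∷ z) eq (suc a) eq′ zero    = ≡.refl
  elements-remove (inside  ∷ z) eq (suc a) eq′ (suc i) =
    ≡.cong suc (elements-remove z (ℕₚ.suc-injective eq) a (ℕₚ.suc-injective eq′) i)

  -- Every element of `z` passed before the chosen one costs one `ε`, which produces the alternating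
  -- sign. The irrelevant equation lets the sum run over `Fin n`, the index type that `det` expects,
  -- without transporting along the size of `z`.
  wedge-laplace : ∀ {m n} (b : Fin m → Carrier) (f : Form m) z .(eq : n ≡ ∣ z ∣) →
    wedge b f z ≈ sum λ (a : Fin n) →
      ε ^ toℕ a * (b (elements z (Fin.cast eq a)) * f (remove z (Fin.cast eq a)))
  wedge-laplace {n = zero}  b f []            eq = refl
  wedge-laplace             b f (outside ∷ z) eq = wedge-laplace (b ∘ suc) (f ∘ (outside ∷_)) z eq
  wedge-laplace {n = suc n} b f (inside  ∷ z) eq = +-cong
    (sym (*-identityˡ _))
    (begin
      ε * wedge (b ∘ suc) (f ∘ (inside ∷_)) z
        ≈⟨ *-congˡ (wedge-laplace (b ∘ suc) (f ∘ (inside ∷_)) z (ℕₚ.suc-injective eq)) ⟩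
      ε * sum (λ a → ε ^ toℕ a * term a)
        ≈⟨ *-distribˡ-sum ε (λ a → ε ^ toℕ a * term a) ⟩
      sum (λ a → ε * (ε ^ toℕ a * term a))
        ≈⟨ sum-cong-≋ (λ a → sym (*-assoc ε (ε ^ toℕ a) (term a))) ⟩
      sum (λ a → ε * ε ^ toℕ a * term a) ∎)
    where
    term : Fin n → Carrier
    term a = b (suc (elements z (Fin.cast (ℕₚ.suc-injective eq) a))) *
             f (inside ∷ remove z (Fin.cast (ℕₚ.suc-injective eq) a))

  -- The outermost vector `B zero` is the first column, along which `det` expands; so both sides
  -- obey the same recursion.
  wedges-det : ∀ {N m} (B : Fin N → Fin m → Carrier) z (eq : N ≡ ∣ z ∣) →
               wedges B z ≈ det (λ i l → B l (elements z (Fin.cast eq i)))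
  wedges-det {zero}  B []            eq = refl
  wedges-det {zero}  B (outside ∷ z) eq = wedges-det {zero} (λ ()) z eq
  wedges-det {suc N} B z eq = begin
    wedge (B zero) (wedges (B ∘ suc)) z
      ≈⟨ wedge-laplace (B zero) (wedges (B ∘ suc)) z eq ⟩
    sum (λ a → ε ^ toℕ a *
          (B zero (elements z (Fin.cast eq a)) * wedges (B ∘ suc) (remove z (Fin.cast eq a))))
      ≈⟨ sum-cong-≋ (λ a → *-congˡ {ε ^ toℕ a} (*-congˡ {B zero (elements z (Fin.cast eq a))} (trans
           (wedges-det (B ∘ suc) (remove z (Fin.cast eq a)) (size a))
           (det-cong λ i l → reflexive (≡.cong (B (suc l)) (elements-remove z eq a (size a) i)))))) ⟩
    det (λ i l → B l (elements z (Fin.cast eq i))) ∎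
    where
    size : ∀ a → N ≡ ∣ remove z (Fin.cast eq a) ∣
    size a = ℕₚ.suc-injective (≡.trans eq (≡.sym (∣remove∣ z (Fin.cast eq a))))

  -- The homomorphism of exterior algebras induced by the linear map e_k ↦ P k.
  induced : ∀ {m N} → (Fin m → Fin N → Carrier) → Form m → Form N
  induced {zero}  P f z = f [] * unit z
  induced {suc m} P f z =
    induced (P ∘ suc) (f ∘ (outside ∷_)) z +
    wedge (P zero) (induced (P ∘ suc) (f ∘ (inside ∷_))) z

  induced-cong : ∀ {m N} (P : Fin m → Fin N → Carrier) {f g : Form m} →
                 (∀ y → f y ≈ g y) → ∀ z → induced P f z ≈ induced P g z
  induced-cong {zero}  P f≈g z = *-congʳ (f≈g [])
  induced-cong {suc m} P f≈g z = +-cong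
    (induced-cong (P ∘ suc) (f≈g ∘ (outside ∷_)) z)
    (wedge-congʳ (P zero) (induced-cong (P ∘ suc) (f≈g ∘ (inside ∷_))) z)

  induced-linear : ∀ {m N} (P : Fin m → Fin N → Carrier) t (f g : Form m) z →
                   induced P (λ y → t * f y + g y) z ≈ t * induced P f z + induced P g z
  induced-linear {zero}  P t f g z = trans (distribʳ _ _ _) (+-congʳ (*-assoc _ _ _))
  induced-linear {suc m} P t f g z = trans
    (+-cong (induced-linear P′ t (f ∘ (outside ∷_)) (g ∘ (outside ∷_)) z)
      (trans (wedge-congʳ (P zero) (induced-linear P′ t (f ∘ (inside ∷_)) (g ∘ (inside ∷_))) z)
        (wedge-linear (P zero) t (induced P′ (f ∘ (inside ∷_))) (induced P′ (g ∘ (inside ∷_))) z)))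
    (solve 5 (λ t p q v w → (t :* p :+ q) :+ (t :* v :+ w) := t :* (p :+ v) :+ (q :+ w)) refl
      t (induced P′ (f ∘ (outside ∷_)) z) (induced P′ (g ∘ (outside ∷_)) z)
      (wedge (P zero) (induced P′ (f ∘ (inside ∷_))) z)
      (wedge (P zero) (induced P′ (g ∘ (inside ∷_))) z))
    where
    P′ : Fin m → Fin _ → Carrier
    P′ = P ∘ suc

  induced-zero : ∀ {m N} (P : Fin m → Fin N → Carrier) z → induced P (λ _ → 0#) z ≈ 0#
  induced-zero {zero}  P z = zeroˡ _
  induced-zero {suc m} P z = trans
    (+-cong (induced-zero (P ∘ suc) z)
      (trans (wedge-congʳ (P zero) (induced-zero (P ∘ suc)) z) (wedge-zeroʳ (P zero) z)))
    (+-identityˡ 0#)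

  induced-unit : ∀ {m N} (P : Fin m → Fin N → Carrier) z → induced P unit z ≈ unit z
  induced-unit {zero}  P z = *-identityˡ _
  induced-unit {suc m} P z = trans
    (+-cong (induced-unit (P ∘ suc) z)
      (trans (wedge-congʳ (P zero) (induced-zero (P ∘ suc)) z) (wedge-zeroʳ (P zero) z)))
    (+-identityʳ _)

  apply : ∀ {m N} → (Fin m → Fin N → Carrier) → (Fin m → Carrier) → Fin N → Carrier
  apply P b i = sum λ k → b k * P k i

  -- Split off e₀ from both b and f. The sign from moving b′ past e₀ is undone by anticommuting
  -- their images, and the image of e₀ ∧ e₀, which would obstruct multiplicativity, is zero by
  -- `wedge-self`.
  induced-wedge : ∀ {m N} (P : Fin m → Fin N → Carrier) b f z →
                  induced P (wedge b f) z ≈ wedge (apply P b) (induced P f) z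
  induced-wedge {zero}  P b f z = trans (zeroˡ _) (sym (wedge-zeroˡ (λ _ → refl) (induced P f) z))
  induced-wedge {suc m} {N} P b f z = begin
    induced P′ (wedge b′ fₒ) z + wedge P₀ (induced P′ (λ y → b zero * fₒ y + ε * wedge b′ fᵢ y)) z
      ≈⟨ +-cong (induced-wedge P′ b′ fₒ z) (wedge-congʳ P₀ inner z) ⟩
    wedge Pb (induced P′ fₒ) z +
      wedge P₀ (λ y → b zero * induced P′ fₒ y + ε * wedge Pb (induced P′ fᵢ) y) z
      ≈⟨ +-congˡ (trans
           (wedge-linear P₀ (b zero) (induced P′ fₒ) (λ y → ε * wedge Pb (induced P′ fᵢ) y) z)
           (+-congˡ (trans (wedge-scale P₀ ε (wedge Pb (induced P′ fᵢ)) z)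
             (sym (wedge-anticomm Pb P₀ (induced P′ fᵢ) z))))) ⟩
    wedge Pb (induced P′ fₒ) z +
      (b zero * wedge P₀ (induced P′ fₒ) z + wedge Pb (wedge P₀ (induced P′ fᵢ)) z)
      ≈⟨ solve 3 (λ x y w → x :+ (y :+ w) := y :+ (x :+ w)) refl
           (wedge Pb (induced P′ fₒ) z) (b zero * wedge P₀ (induced P′ fₒ) z)
           (wedge Pb (wedge P₀ (induced P′ fᵢ)) z) ⟩
    b zero * wedge P₀ (induced P′ fₒ) z +
      (wedge Pb (induced P′ fₒ) z + wedge Pb (wedge P₀ (induced P′ fᵢ)) z)
      ≈⟨ +-cong (*-congˡ (sym P₀-induced))
           (sym (wedge-+ Pb (induced P′ fₒ) (wedge P₀ (induced P′ fᵢ)) z)) ⟩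
    b zero * wedge P₀ (induced P f) z + wedge Pb (induced P f) z
      ≈⟨ wedge-linearˡ (b zero) P₀ Pb (induced P f) z ⟨
    wedge (apply P b) (induced P f) z ∎
    where
    P₀ Pb : Fin N → Carrier
    P₀ = P zero
    b′ : Fin m → Carrier
    b′ = b ∘ suc
    P′ : Fin m → Fin N → Carrier
    P′ = P ∘ suc
    Pb = apply P′ b′
    fₒ fᵢ : Form m
    fₒ = f ∘ (outside ∷_)
    fᵢ = f ∘ (inside ∷_)
    inner : ∀ y → induced P′ (λ y → b zero * fₒ y + ε * wedge b′ fᵢ y) y ≈
                  b zero * induced P′ fₒ y + ε * wedge Pb (induced P′ fᵢ) y
    inner y = trans (induced-linear P′ (b zero) fₒ (λ y → ε * wedge b′ fᵢ y) y)
      (+-congˡ (begin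
        induced P′ (λ y → ε * wedge b′ fᵢ y) y
          ≈⟨ induced-cong P′ (λ y → sym (+-identityʳ (ε * wedge b′ fᵢ y))) y ⟩
        induced P′ (λ y → ε * wedge b′ fᵢ y + 0#) y
          ≈⟨ induced-linear P′ ε (wedge b′ fᵢ) (λ _ → 0#) y ⟩
        ε * induced P′ (wedge b′ fᵢ) y + induced P′ (λ _ → 0#) y
          ≈⟨ +-cong (*-congˡ (induced-wedge P′ b′ fᵢ y)) (induced-zero P′ y) ⟩
        ε * wedge Pb (induced P′ fᵢ) y + 0#
          ≈⟨ +-identityʳ _ ⟩
        ε * wedge Pb (induced P′ fᵢ) y ∎))
    -- The part of the image coming from fᵢ already contains the factor P₀.
    P₀-induced : wedge P₀ (induced P f) z ≈ wedge P₀ (induced P′ fₒ) z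
    P₀-induced = begin
      wedge P₀ (induced P f) z
        ≈⟨ wedge-+ P₀ (induced P′ fₒ) (wedge P₀ (induced P′ fᵢ)) z ⟩
      wedge P₀ (induced P′ fₒ) z + wedge P₀ (wedge P₀ (induced P′ fᵢ)) z
        ≈⟨ +-congˡ (wedge-self P₀ (induced P′ fᵢ) z) ⟩
      wedge P₀ (induced P′ fₒ) z + 0#
        ≈⟨ +-identityʳ _ ⟩
      wedge P₀ (induced P′ fₒ) z ∎

  induced-wedges : ∀ {k m N} (P : Fin m → Fin N → Carrier) (B : Fin k → Fin m → Carrier) z →
                   induced P (wedges B) z ≈ wedges (apply P ∘ B) z
  induced-wedges {zero}  P B z = induced-unit P z
  induced-wedges {suc k} P B z = trans (induced-wedge P (B zero) (wedges (B ∘ suc)) z)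
    (wedge-congʳ (apply P (B zero)) (induced-wedges P (B ∘ suc)) z)

  wedge-∑ : ∀ {a} {A : Set a} {m} (b : Fin m → Carrier) (xs : List A)
            (t : A → Carrier) (f : A → Form m) z →
            wedge b (λ w → ∑ xs λ y → t y * f y w) z ≈ ∑ xs λ y → t y * wedge b (f y) z
  wedge-∑ b []       t f z = wedge-zeroʳ b z
  wedge-∑ b (x ∷ xs) t f z = trans
    (wedge-linear b (t x) (f x) (λ w → ∑ xs λ y → t y * f y w) z) (+-congˡ (wedge-∑ b xs t f z))

  -- The basis vector e_y is sent to the wedge of the `P k`, k in y, in increasing order. Both
  -- `induced` and `allSubsets` branch on the first coordinate, so the recursions agree.
  induced-expand : ∀ {m N} (P : Fin m → Fin N → Carrier) f z →
    induced P f z ≈ ∑ (allSubsets m) λ y → f y * wedges (P ∘ elements y) z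
  induced-expand {zero}  P f z = sym (+-identityʳ _)
  induced-expand {suc m} P f z = begin
    induced P′ (f ∘ (outside ∷_)) z + wedge (P zero) (induced P′ (f ∘ (inside ∷_))) z
      ≈⟨ +-cong (induced-expand P′ (f ∘ (outside ∷_)) z)
           (trans (wedge-congʳ (P zero) (induced-expand P′ (f ∘ (inside ∷_))) z)
             (wedge-∑ (P zero) (allSubsets m) (f ∘ (inside ∷_)) (λ y → wedges (P′ ∘ elements y)) z)) ⟩
    ∑ (allSubsets m) (F ∘ (outside ∷_)) + ∑ (allSubsets m) (F ∘ (inside ∷_))
      ≈⟨ +-cong (∑-map (outside ∷_) (allSubsets m) F) (∑-map (inside ∷_) (allSubsets m) F) ⟨
    ∑ (List.map (outside ∷_) (allSubsets m)) F + ∑ (List.map (inside ∷_) (allSubsets m)) F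
      ≈⟨ ∑-++ (List.map (outside ∷_) (allSubsets m)) (List.map (inside ∷_) (allSubsets m)) F ⟨
    ∑ (allSubsets (suc m)) F ∎
    where
    P′ : Fin m → Fin _ → Carrier
    P′ = P ∘ suc
    F : Subset (suc m) → Carrier
    F y = f y * wedges (P ∘ elements y) z

  elements-⊤ : ∀ {N} .(eq : N ≡ ∣ ⊤ {N} ∣) i → elements (⊤ {N}) (Fin.cast eq i) ≡ i
  elements-⊤ eq zero    = ≡.refl
  elements-⊤ eq (suc i) = ≡.cong suc (elements-⊤ (ℕₚ.suc-injective eq) i)

  wedges-⊤ : ∀ {N} (B : Fin N → Fin N → Carrier) → wedges B ⊤ ≈ det (λ i l → B l i)
  wedges-⊤ {N} B = trans (wedges-det B ⊤ eq)
    (det-cong λ i l → reflexive (≡.cong (B l) (elements-⊤ eq i)))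
    where
    eq : N ≡ ∣ ⊤ {N} ∣
    eq = ≡.sym (∣⊤∣≡n N)

  wedges-cast : ∀ {k N m} (eq : N ≡ k) (B : Fin k → Fin m → Carrier) z →
                wedges B z ≈ wedges (B ∘ Fin.cast eq) z
  wedges-cast ≡.refl B = wedges-cong λ l i →
    reflexive (≡.cong (λ l → B l i) (≡.sym (Finₚ.cast-is-id ≡.refl l)))

  -- Functoriality read off at the top coordinate. The sum keeps subsets of every size, which avoids
  -- carrying size proofs; those without exactly N elements contribute zero by homogeneity.
  cauchy-binet : ∀ {m N} (P : Fin m → Fin N → Carrier) (B : Fin N → Fin m → Carrier) →
    det (λ i l → apply P (B l) i) ≈ ∑ (allSubsets m) λ y → wedges B y * wedges (P ∘ elements y) ⊤
  cauchy-binet P B = begin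
    det (λ i l → apply P (B l) i)    ≈⟨ wedges-⊤ (apply P ∘ B) ⟨
    wedges (apply P ∘ B) ⊤           ≈⟨ induced-wedges P B ⊤ ⟨
    induced P (wedges B) ⊤           ≈⟨ induced-expand P (wedges B) ⊤ ⟩
    ∑ (allSubsets _) (λ y → wedges B y * wedges (P ∘ elements y) ⊤) ∎

-- Sorting a wedge of vectors that each lie in one block.

fibre-++-zero : ∀ n {ν} (y : Subset ν) (w : Subset (n Nat.* ν)) →
                Subsets.fibre {suc n} (y Vec.++ w) zero ≡ y
fibre-++-zero n y w = ≡.trans (Vecₚ.tabulate-cong (Vecₚ.lookup-++ˡ y w)) (Vecₚ.tabulate∘lookup y)

fibre-++-suc : ∀ n {ν} (y : Subset ν) (w : Subset (n Nat.* ν)) i →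
               Subsets.fibre {suc n} (y Vec.++ w) (suc i) ≡ Subsets.fibre {n} w i
fibre-++-suc n y w i = Vecₚ.tabulate-cong λ k → Vecₚ.lookup-++ʳ y w (Fin.combine {n} i k)

module Blocks {c ℓ} (R : CommutativeRing c ℓ) where

  open CommutativeRing R hiding (zero)
  open import Algebra.Properties.Semiring.Exp semiring using (_^_)
  open import Algebra.Properties.Semiring.Sum semiring using (sum; sum-cong-≋)
  open import Algebra.Properties.CommutativeMonoid.Sum *-commutativeMonoid
    using () renaming (sum to prod; sum-cong-≋ to prod-cong)
  open import Algebra.Solver.Ring.NaturalCoefficients.Default commutativeSemiring
    using (solve; _:=_; _:+_; _:*_)
  open import Relation.Binary.Reasoning.Setoid setoid
  open Determinants R using (sum-zero)
  open Exterior R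
  open Subsets

  -- The part of b in the last `r` coordinates has to pass the basis vectors of `y`, whence the
  -- power of `ε`.
  wedge-++ : ∀ {m r} (b : Fin (m Nat.+ r) → Carrier) (f : Form (m Nat.+ r))
    (y : Subset m) (w : Subset r) →
    wedge b f (y Vec.++ w) ≈
    wedge (b ∘ (Fin._↑ˡ r)) (λ y′ → f (y′ Vec.++ w)) y +
    ε ^ ∣ y ∣ * wedge (b ∘ (m Fin.↑ʳ_)) (λ w′ → f (y Vec.++ w′)) w
  wedge-++ b f []            w = sym (trans (+-identityˡ _) (*-identityˡ _))
  wedge-++ b f (outside ∷ y) w = wedge-++ (b ∘ suc) (f ∘ (outside ∷_)) y w
  wedge-++ b f (inside  ∷ y) w = trans
    (+-congˡ (*-congˡ (wedge-++ (b ∘ suc) (f ∘ (inside ∷_)) y w)))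
    (solve 5 (λ x e p q v → x :+ e :* (p :+ q :* v) := (x :+ e :* p) :+ (e :* q) :* v) refl
      (b zero * f (outside ∷ y Vec.++ w)) ε _ (ε ^ ∣ y ∣) _)

  unit-++ : ∀ {m r} (y : Subset m) (w : Subset r) → unit (y Vec.++ w) ≈ unit y * unit w
  unit-++ []            w = sym (*-identityˡ _)
  unit-++ (outside ∷ y) w = unit-++ y w
  unit-++ (inside  ∷ y) w = sym (zeroˡ _)

  block : ∀ {n ν} → Fin n → (Fin ν → Carrier) → Fin (n Nat.* ν) → Carrier
  block {suc n} {ν} zero    b q = [ b , (λ _ → 0#) ] (Fin.splitAt ν q)
  block {suc n} {ν} (suc s) b q = [ (λ _ → 0#) , block {n} s b ] (Fin.splitAt ν q)

  block-↑ˡ-zero : ∀ {n ν} (b : Fin ν → Carrier) k →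
                  block {suc n} zero b (k Fin.↑ˡ (n Nat.* ν)) ≡ b k
  block-↑ˡ-zero {n} {ν} b k = ≡.cong [ b , _ ] (Finₚ.splitAt-↑ˡ ν k (n Nat.* ν))

  block-↑ʳ-zero : ∀ {n ν} (b : Fin ν → Carrier) q → block {suc n} zero b (ν Fin.↑ʳ q) ≡ 0#
  block-↑ʳ-zero {n} {ν} b q = ≡.cong [ b , _ ] (Finₚ.splitAt-↑ʳ ν (n Nat.* ν) q)

  block-↑ˡ-suc : ∀ {n ν} (s : Fin n) (b : Fin ν → Carrier) k →
                 block (suc s) b (k Fin.↑ˡ (n Nat.* ν)) ≡ 0#
  block-↑ˡ-suc {n} {ν} s b k = ≡.cong [ _ , block s b ] (Finₚ.splitAt-↑ˡ ν k (n Nat.* ν))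

  block-↑ʳ-suc : ∀ {n ν} (s : Fin n) (b : Fin ν → Carrier) q →
                 block (suc s) b (ν Fin.↑ʳ q) ≡ block s b q
  block-↑ʳ-suc {n} {ν} s b q = ≡.cong [ _ , block s b ] (Finₚ.splitAt-↑ʳ ν (n Nat.* ν) q)

  sum-++ : ∀ m {r} (f : Fin (m Nat.+ r) → Carrier) →
           sum f ≈ sum (f ∘ (Fin._↑ˡ r)) + sum (f ∘ (m Fin.↑ʳ_))
  sum-++ zero    f = sym (+-identityˡ _)
  sum-++ (suc m) f = trans (+-congˡ (sum-++ m (f ∘ suc))) (sym (+-assoc _ _ _))

  sum-block : ∀ {n ν} (s : Fin n) (b : Fin ν → Carrier) (g : Fin (n Nat.* ν) → Carrier) →
              sum (λ q → block s b q * g q) ≈ sum λ k → b k * g (Fin.combine s k)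
  sum-block {suc n} {ν} zero b g = begin
    sum (λ q → block {suc n} zero b q * g q)
      ≈⟨ sum-++ ν (λ q → block {suc n} zero b q * g q) ⟩
    sum (λ k → block {suc n} zero b (k Fin.↑ˡ (n Nat.* ν)) * g (k Fin.↑ˡ (n Nat.* ν))) +
    sum (λ q → block {suc n} zero b (ν Fin.↑ʳ q) * g (ν Fin.↑ʳ q))
      ≈⟨ +-cong (sum-cong-≋ λ k → *-congʳ (reflexive (block-↑ˡ-zero {n} b k)))
           (sum-zero λ (q : Fin (n Nat.* ν)) →
             trans (*-congʳ (reflexive (block-↑ʳ-zero {n} b q))) (zeroˡ _)) ⟩
    sum (λ k → b k * g (k Fin.↑ˡ (n Nat.* ν))) + 0#
      ≈⟨ +-identityʳ _ ⟩
    sum (λ k → b k * g (k Fin.↑ˡ (n Nat.* ν))) ∎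
  sum-block {suc n} {ν} (suc s) b g = begin
    sum (λ q → block (suc s) b q * g q)
      ≈⟨ sum-++ ν (λ q → block (suc s) b q * g q) ⟩
    sum (λ k → block (suc s) b (k Fin.↑ˡ (n Nat.* ν)) * g (k Fin.↑ˡ (n Nat.* ν))) +
    sum (λ q → block (suc s) b (ν Fin.↑ʳ q) * g (ν Fin.↑ʳ q))
      ≈⟨ +-cong (sum-zero λ k → trans (*-congʳ (reflexive (block-↑ˡ-suc s b k))) (zeroˡ _))
           (sum-cong-≋ λ q → *-congʳ (reflexive (block-↑ʳ-suc s b q))) ⟩
    0# + sum (λ q → block s b q * g (ν Fin.↑ʳ q))
      ≈⟨ +-identityˡ _ ⟩
    sum (λ q → block s b q * g (ν Fin.↑ʳ q))
      ≈⟨ sum-block s b (g ∘ (ν Fin.↑ʳ_)) ⟩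
    sum (λ k → b k * g (ν Fin.↑ʳ Fin.combine s k)) ∎

  -- The exterior product g₀ ∧ g₁ ∧ ... of forms on successive blocks. Its factors stand in block
  -- order, so its coordinates carry no sign.
  tensor : ∀ {n ν} → (Fin n → Form ν) → Form (n Nat.* ν)
  tensor {n} g z = prod λ i → g i (fibre {n} z i)

  tensor-++ : ∀ {n ν} (g : Fin (suc n) → Form ν) (y : Subset ν) (w : Subset (n Nat.* ν)) →
              tensor g (y Vec.++ w) ≈ g zero y * tensor (g ∘ suc) w
  tensor-++ {n} g y w = *-cong (reflexive (≡.cong (g zero) (fibre-++-zero n y w)))
    (prod-cong λ i → reflexive (≡.cong (g (suc i)) (fibre-++-suc n y w i)))

  tensor-unit : ∀ n {ν} (z : Subset (n Nat.* ν)) → unit z ≈ tensor {n} (λ _ → unit) z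
  tensor-unit zero    []    = refl
  tensor-unit (suc n) {ν} z with Vec.splitAt ν z
  ... | y , w , ≡.refl = trans (unit-++ y w)
    (trans (*-congˡ (tensor-unit n w)) (sym (tensor-++ {n} (λ _ → unit) y w)))

  -- The sign of moving a vector of the s-th block past d i vectors of each block i < s.
  shiftSign : ∀ {n} → Fin n → (Fin n → ℕ) → Carrier
  shiftSign zero    d = 1#
  shiftSign (suc s) d = ε ^ d zero * shiftSign s (d ∘ suc)

  -- The vector moves past the factors of the earlier blocks and is absorbed by the s-th one. The
  -- updated family `g′` is specified pointwise so that `letterWedges` of a longer word can be
  -- supplied directly.
  wedge-block : ∀ {n ν} (s : Fin n) (b : Fin ν → Carrier) (d : Fin n → ℕ) (g g′ : Fin n → Form ν) →
    (∀ i y → ∣ y ∣ ≢ d i → g i y ≈ 0#) →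
    (∀ y → g′ s y ≈ wedge b (g s) y) →
    (∀ i → i ≢ s → ∀ y → g′ i y ≈ g i y) →
    ∀ z → wedge (block s b) (tensor g) z ≈ shiftSign s d * tensor g′ z
  wedge-block {suc n} {ν} zero b d g g′ hom new old z with Vec.splitAt ν z
  ... | y , w , ≡.refl = begin
    wedge (block {suc n} zero b) (tensor g) (y Vec.++ w)
      ≈⟨ wedge-++ (block {suc n} zero b) (tensor g) y w ⟩
    wedge _ (λ y′ → tensor g (y′ Vec.++ w)) y + ε ^ ∣ y ∣ * wedge _ (λ w′ → tensor g (y Vec.++ w′)) w
      ≈⟨ +-cong
           (wedge-cong (λ k → reflexive (block-↑ˡ-zero {n} b k))
             (λ y′ → trans (tensor-++ g y′ w) (*-comm _ _)) y)
           (trans (*-congˡ (wedge-zeroˡ (λ q → reflexive (block-↑ʳ-zero {n} b q))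
             (λ w′ → tensor g (y Vec.++ w′)) w)) (zeroʳ _)) ⟩
    wedge b (λ y′ → tensor (g ∘ suc) w * g zero y′) y + 0#
      ≈⟨ trans (+-identityʳ _) (wedge-scale b (tensor (g ∘ suc) w) (g zero) y) ⟩
    tensor (g ∘ suc) w * wedge b (g zero) y
      ≈⟨ *-cong (prod-cong λ i → sym (old (suc i) (λ ()) (fibre {n} w i))) (sym (new y)) ⟩
    tensor (g′ ∘ suc) w * g′ zero y
      ≈⟨ trans (*-comm _ _) (sym (tensor-++ g′ y w)) ⟩
    tensor g′ (y Vec.++ w)
      ≈⟨ *-identityˡ _ ⟨
    1# * tensor g′ (y Vec.++ w) ∎
  wedge-block {suc n} {ν} (suc s) b d g g′ hom new old z with Vec.splitAt ν z
  ... | y , w , ≡.refl = begin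
    wedge (block (suc s) b) (tensor g) (y Vec.++ w)
      ≈⟨ wedge-++ (block (suc s) b) (tensor g) y w ⟩
    wedge _ (λ y′ → tensor g (y′ Vec.++ w)) y + ε ^ ∣ y ∣ * wedge _ (λ w′ → tensor g (y Vec.++ w′)) w
      ≈⟨ +-cong
           (wedge-zeroˡ (λ k → reflexive (block-↑ˡ-suc s b k)) (λ y′ → tensor g (y′ Vec.++ w)) y)
           (*-congˡ (wedge-cong (λ q → reflexive (block-↑ʳ-suc s b q)) (tensor-++ g y) w)) ⟩
    0# + ε ^ ∣ y ∣ * wedge (block s b) (λ w′ → g zero y * tensor (g ∘ suc) w′) w
      ≈⟨ trans (+-identityˡ _) (*-congˡ (trans
           (wedge-scale (block s b) (g zero y) (tensor (g ∘ suc)) w)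
           (*-congˡ (wedge-block s b (d ∘ suc) (g ∘ suc) (g′ ∘ suc) (hom ∘ suc) new
             (λ i i≢ → old (suc i) (i≢ ∘ Finₚ.suc-injective)) w)))) ⟩
    ε ^ ∣ y ∣ * (g zero y * (shiftSign s (d ∘ suc) * tensor (g′ ∘ suc) w))
      ≈⟨ *-assoc _ _ _ ⟨
    ε ^ ∣ y ∣ * g zero y * (shiftSign s (d ∘ suc) * tensor (g′ ∘ suc) w)
      ≈⟨ *-congʳ (trans degree (*-congˡ (sym (old zero (λ ()) y)))) ⟩
    ε ^ d zero * g′ zero y * (shiftSign s (d ∘ suc) * tensor (g′ ∘ suc) w)
      ≈⟨ solve 4 (λ a b c d → (a :* b) :* (c :* d) := (a :* c) :* (b :* d)) refl
           (ε ^ d zero) (g′ zero y) (shiftSign s (d ∘ suc)) (tensor (g′ ∘ suc) w) ⟩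
    ε ^ d zero * shiftSign s (d ∘ suc) * (g′ zero y * tensor (g′ ∘ suc) w)
      ≈⟨ *-congˡ (tensor-++ g′ y w) ⟨
    ε ^ d zero * shiftSign s (d ∘ suc) * tensor g′ (y Vec.++ w) ∎
    where
    -- The sign depends on `y`, but by homogeneity only subsets of size `d zero` count; for all
    -- others both sides are zero.
    degree : ε ^ ∣ y ∣ * g zero y ≈ ε ^ d zero * g zero y
    degree with ∣ y ∣ ℕₚ.≟ d zero
    ... | yes eq = *-congʳ (reflexive (≡.cong (ε ^_) eq))
    ... | no  ne = trans (*-congˡ (hom zero y ne))
                     (trans (zeroʳ _) (sym (trans (*-congˡ (hom zero y ne)) (zeroʳ _))))

  -- Vectors are multiplied on from the last letter to the first, so a letter `s` moves past exactly
  -- the later letters smaller than `s`.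
  wordSign : ∀ {n N} → Vec (Fin n) N → Carrier
  wordSign []      = 1#
  wordSign (s ∷ v) = wordSign v * shiftSign s (abelianVector v)

  letterWedges : ∀ {n N ν} → Vec (Fin n) N → (Fin N → Fin ν → Carrier) → Fin n → Form ν
  letterWedges v b i = wedges (b ∘ elements (positions v i))

  letterWedges-∷ : ∀ {n N ν} s (v : Vec (Fin n) N) (b : Fin (suc N) → Fin ν → Carrier) y →
                   letterWedges (s ∷ v) b s y ≡ wedge (b zero) (letterWedges v (b ∘ suc) s) y
  letterWedges-∷ s v b y rewrite dec-true (s Finₚ.≟ s) ≡.refl = ≡.refl

  letterWedges-∷-≢ : ∀ {n N ν} s (v : Vec (Fin n) N) (b : Fin (suc N) → Fin ν → Carrier) i →
                     i ≢ s → ∀ y → letterWedges (s ∷ v) b i y ≡ letterWedges v (b ∘ suc) i y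
  letterWedges-∷-≢ s v b i i≢s y rewrite dec-false (s Finₚ.≟ i) (i≢s ∘ ≡.sym) = ≡.refl

  wedges-blocks : ∀ {n N ν} (v : Vec (Fin n) N) (b : Fin N → Fin ν → Carrier) z →
    wedges (λ l → block (Vec.lookup v l) (b l)) z ≈ wordSign v * tensor (letterWedges v b) z
  wedges-blocks {n} []      b z = trans (tensor-unit n z) (sym (*-identityˡ _))
  wedges-blocks     (s ∷ v) b z = begin
    wedge (block s (b zero)) (wedges λ l → block (Vec.lookup v l) (b (suc l))) z
      ≈⟨ wedge-congʳ (block s (b zero)) (wedges-blocks v (b ∘ suc)) z ⟩
    wedge (block s (b zero)) (λ w → wordSign v * tensor (letterWedges v (b ∘ suc)) w) z
      ≈⟨ wedge-scale (block s (b zero)) (wordSign v) (tensor (letterWedges v (b ∘ suc))) z ⟩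
    wordSign v * wedge (block s (b zero)) (tensor (letterWedges v (b ∘ suc))) z
      ≈⟨ *-congˡ (wedge-block s (b zero) (abelianVector v)
           (letterWedges v (b ∘ suc)) (letterWedges (s ∷ v) b)
           -- The factor of the letter i is a wedge of `abelianVector v i` vectors, which fixes its
           -- degree.
           (λ i → wedges-homogeneous (b ∘ suc ∘ elements (positions v i)))
           (λ y → reflexive (letterWedges-∷ s v b y))
           (λ i i≢s y → reflexive (letterWedges-∷-≢ s v b i i≢s y)) z) ⟩
    wordSign v * (shiftSign s (abelianVector v) * tensor (letterWedges (s ∷ v) b) z)
      ≈⟨ *-assoc _ _ _ ⟨
    wordSign v * shiftSign s (abelianVector v) * tensor (letterWedges (s ∷ v) b) z ∎

-- The inversion sign and the Vandermonde divisor.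

∣∷∣ : ∀ {m} b (p : Subset m) → ∣ b ∷ p ∣ ≡ (if b then suc ∣ p ∣ else ∣ p ∣)
∣∷∣ true  p = ≡.refl
∣∷∣ false p = ≡.refl

module Products {c ℓ} (R : CommutativeRing c ℓ) where

  open CommutativeRing R hiding (zero)
  open import Algebra.Properties.Semiring.Exp semiring using (_^_)
  open import Algebra.Properties.CommutativeMonoid.Sum *-commutativeMonoid
    using () renaming (sum to prod; sum-cong-≋ to prod-cong; sum-replicate-zero to prod-replicate-1)
  open import Algebra.Properties.CommutativeSemigroup *-commutativeSemigroup using (x∙yz≈y∙xz)
  open import Relation.Binary.Reasoning.Setoid setoid
  open Determinants R using (vandermonde; vandermonde-suc)
  open Exterior R using (ε)
  open Blocks R using (shiftSign; wordSign)
  open ListSum *-commutativeMonoid using (sum-pairs-suc)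
    renaming (∑ to ∏; ∑-filter to ∏-filter; ∑-filter-pairs to ∏-filter-pairs;
              ∑-tabulate to ∏-tabulate)
  open Subsets

  ^-length : ∀ {a} {A : Set a} t (xs : List A) → t ^ List.length xs ≈ ∏ xs λ _ → t
  ^-length t []       = refl
  ^-length t (x ∷ xs) = *-congˡ (^-length t xs)

  shiftSign-cong : ∀ {n} (s : Fin n) {d d′ : Fin n → ℕ} → (∀ i → d i ≡ d′ i) →
                   shiftSign s d ≈ shiftSign s d′
  shiftSign-cong zero    d≡d′ = refl
  shiftSign-cong (suc s) d≡d′ =
    *-cong (reflexive (≡.cong (ε ^_) (d≡d′ zero))) (shiftSign-cong s (d≡d′ ∘ suc))

  shiftSign-zero : ∀ {n} (s : Fin n) → shiftSign s (λ _ → 0) ≈ 1#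
  shiftSign-zero zero    = refl
  shiftSign-zero (suc s) = trans (*-identityˡ _) (shiftSign-zero s)

  shiftSign-increment : ∀ {n} (s t : Fin n) (d : Fin n → ℕ) →
    shiftSign s (λ i → if does (t Finₚ.≟ i) then suc (d i) else d i) ≈
    (if does (t Finₚ.<? s) then ε else 1#) * shiftSign s d
  shiftSign-increment zero    t       d = sym (*-identityˡ _)
  shiftSign-increment (suc s) zero    d = *-assoc _ _ _
  shiftSign-increment (suc s) (suc t) d = trans
    (*-congˡ (shiftSign-increment s t (d ∘ suc))) (x∙yz≈y∙xz _ _ _)

  prod-smaller : ∀ {n N} (s : Fin n) (v : Vec (Fin n) N) →
    prod (λ b → if does (Vec.lookup v b Finₚ.<? s) then ε else 1#) ≈ shiftSign s (abelianVector v)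
  prod-smaller s []      = sym (shiftSign-zero s)
  prod-smaller s (t ∷ v) = trans (*-congˡ (prod-smaller s v)) (sym (trans
    (shiftSign-cong s λ i → ∣∷∣ (does (t Finₚ.≟ i)) (positions v i))
    (shiftSign-increment s t (abelianVector v))))

  -- Inversions are grouped by their left position: those at the first letter make up its
  -- `shiftSign`.
  wordSign-inversions : ∀ {n N} (v : Vec (Fin n) N) →
    prod (λ a → prod λ b →
      if does ((a Finₚ.<? b) ×-dec (Vec.lookup v b Finₚ.<? Vec.lookup v a)) then ε else 1#) ≈
    wordSign v
  wordSign-inversions []      = refl
  wordSign-inversions (s ∷ v) = trans
    (sum-pairs-suc
      (λ a b → if does ((a Finₚ.<? b) ×-dec (Vec.lookup (s ∷ v) b Finₚ.<? Vec.lookup (s ∷ v) a))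
               then ε else 1#)
      (λ _ → refl))
    (trans (*-cong (prod-smaller s v) (wordSign-inversions v)) (*-comm _ _))

  ε^inv≈wordSign : ∀ {n N} (v : Vec (Fin n) N) → ε ^ inv v ≈ wordSign v
  ε^inv≈wordSign {N = N} v = trans
    (^-length ε (List.filter inversion? (pairs N)))
    (trans (∏-filter-pairs inversion? (λ _ → ε)) (wordSign-inversions v))
    where
    inversion? : ((a , b) : Fin N × Fin N) → Dec (a Fin.< b × Vec.lookup v b Fin.< Vec.lookup v a)
    inversion? (a , b) = (a Finₚ.<? b) ×-dec (Vec.lookup v b Finₚ.<? Vec.lookup v a)

  prod-elements : ∀ {N} (q : Fin N → Bool) (y : Fin N → Carrier) →
    prod (λ b → if q b then y b else 1#) ≈ prod (y ∘ elements (Vec.tabulate q))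
  prod-elements {zero}  q y = refl
  prod-elements {suc N} q y with q zero
  ... | true  = *-congˡ (prod-elements (q ∘ suc) (y ∘ suc))
  ... | false = trans (*-identityˡ _) (prod-elements (q ∘ suc) (y ∘ suc))

  prod-1 : ∀ {N} {y : Fin N → Carrier} → (∀ j → y j ≈ 1#) → prod y ≈ 1#
  prod-1 {N} y≈1 = trans (prod-cong y≈1) (prod-replicate-1 N)

  -- If the first position satisfies `q`, its pairs give exactly the factor split off by
  -- `vandermonde-suc`; otherwise they contribute 1.
  prod-differences : ∀ {N} (q : Fin N → Bool) (y : Fin N → Carrier) →
    prod (λ a → prod λ b → if does (a Finₚ.<? b) ∧ (q a ∧ q b) then y b - y a else 1#) ≈
    vandermonde (y ∘ elements (Vec.tabulate q))
  prod-differences {zero}  q y = refl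
  prod-differences {suc N} q y = trans
    (sum-pairs-suc (λ a b → if does (a Finₚ.<? b) ∧ (q a ∧ q b) then y b - y a else 1#) (λ _ → refl))
    (trans (*-congˡ (prod-differences (q ∘ suc) (y ∘ suc))) split)
    where
    split : prod (λ b → if q zero ∧ q (suc b) then y (suc b) - y zero else 1#) *
            vandermonde (y ∘ suc ∘ elements (Vec.tabulate (q ∘ suc))) ≈
            vandermonde (y ∘ elements (Vec.tabulate q))
    split with q zero
    ... | true  = trans (*-congʳ (prod-elements (q ∘ suc) (λ b → y (suc b) - y zero)))
                    (sym (vandermonde-suc (y ∘ elements (inside ∷ Vec.tabulate (q ∘ suc)))))
    ... | false = trans (*-congʳ (prod-1 {N} (λ _ → refl))) (*-identityˡ _)

  -- Accounts for the letters that `𝒱` leaves out.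
  vandermonde-small : ∀ {n} (y : Fin n → Carrier) → ¬ 2 Nat.≤ n → vandermonde y ≈ 1#
  vandermonde-small {zero}        y 2≰n = refl
  vandermonde-small {suc zero}    y 2≰n = trans (+-identityʳ _) (trans (*-identityˡ _) (*-identityˡ _))
  vandermonde-small {suc (suc n)} y 2≰n = contradiction (Nat.s≤s (Nat.s≤s Nat.z≤n)) 2≰n

  -- Over polynomials, with `y` the variables, the left side is what `𝒱 v` unfolds to, and the right
  -- side is the product of the denominators of the Schur functions.
  vandermonde-divisor : ∀ {n N} (v : Vec (Fin n) N) (y : Fin N → Carrier) →
    ∏ (List.filter (λ i → 2 ℕₚ.≤? abelianVector v i) (List.allFin n)) (λ i →
      ∏ (List.filter (λ (j , k) → (j Finₚ.<? k) ×-dec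
                        ((Vec.lookup v j Finₚ.≟ i) ×-dec (Vec.lookup v k Finₚ.≟ i))) (pairs N))
        λ (j , k) → y k - y j) ≈
    prod λ i → vandermonde (y ∘ elements (positions v i))
  vandermonde-divisor {n} {N} v y = begin
    ∏ (List.filter (λ i → 2 ℕₚ.≤? abelianVector v i) (List.allFin n)) differences
      ≈⟨ ∏-filter (λ i → 2 ℕₚ.≤? abelianVector v i) (List.allFin n) differences ⟩
    ∏ (List.allFin n) large
      ≈⟨ ∏-tabulate id large ⟩
    prod large
      ≈⟨ prod-cong (λ i → large-vandermonde i (2 ℕₚ.≤? abelianVector v i)) ⟩
    prod (λ i → vandermonde (y ∘ elements (positions v i))) ∎
    where
    ordered? : ∀ i ((j , k) : Fin N × Fin N) →
               Dec (j Fin.< k × (Vec.lookup v j ≡ i × Vec.lookup v k ≡ i))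
    ordered? i (j , k) =
      (j Finₚ.<? k) ×-dec ((Vec.lookup v j Finₚ.≟ i) ×-dec (Vec.lookup v k Finₚ.≟ i))
    differences large : Fin n → Carrier
    differences i = ∏ (List.filter (ordered? i) (pairs N)) λ (j , k) → y k - y j
    large i = if does (2 ℕₚ.≤? abelianVector v i) then differences i else 1#
    large-vandermonde : ∀ i (large? : Dec (2 Nat.≤ abelianVector v i)) →
      (if does large? then differences i else 1#) ≈ vandermonde (y ∘ elements (positions v i))
    large-vandermonde i (no 2≰α) = sym (vandermonde-small (y ∘ elements (positions v i)) 2≰α)
    large-vandermonde i (yes _)  = trans (∏-filter-pairs (ordered? i) (λ (j , k) → y k - y j))
      (prod-differences (λ j → does (Vec.lookup v j Finₚ.≟ i)) y)

-- Ring homomorphisms and clearing denominators.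

IsHomomorphism : ∀ {a b c d} (S : CommutativeRing a b) (T : CommutativeRing c d) →
                 (CommutativeRing.Carrier S → CommutativeRing.Carrier T) → Set _
IsHomomorphism S T = IsRingHomomorphism (CommutativeRing.rawRing S) (CommutativeRing.rawRing T)

module Homomorphism {a b c d} (S : CommutativeRing a b) (T : CommutativeRing c d)
  {φ : CommutativeRing.Carrier S → CommutativeRing.Carrier T} (φ-hom : IsHomomorphism S T φ) where

  private
    module S where
      open CommutativeRing S public
      open import Algebra.Properties.Semiring.Exp semiring using (_^_) public
      open import Algebra.Properties.Semiring.Sum semiring using (sum) public
      open import Algebra.Properties.CommutativeMonoid.Sum *-commutativeMonoid
        using () renaming (sum to prod) public
      open Determinants S using (det; minor) public
      open ListSum +-commutativeMonoid using (∑) public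
  open CommutativeRing T hiding (zero)
  open import Algebra.Properties.Semiring.Exp semiring using (_^_)
  open import Algebra.Properties.Semiring.Sum semiring using (sum; sum-cong-≋)
  open import Algebra.Properties.CommutativeMonoid.Sum *-commutativeMonoid
    using () renaming (sum to prod; sum-cong-≋ to prod-cong; ∑-distrib-+ to prod-distrib-*)
  open import Algebra.Solver.Ring.NaturalCoefficients.Default commutativeSemiring
    using (solve; _:=_; _:+_; _:*_)
  open Determinants T using (det)
  open ListSum +-commutativeMonoid using (∑)
  open IsRingHomomorphism φ-hom
    using (⟦⟧-cong; +-homo; *-homo; 0#-homo; 1#-homo; -‿homo)
  open import Relation.Binary.Reasoning.Setoid setoid

  sum-homo : ∀ {n} (f : Fin n → S.Carrier) → φ (S.sum f) ≈ sum (φ ∘ f)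
  sum-homo {zero}  f = 0#-homo
  sum-homo {suc n} f = trans (+-homo _ _) (+-congˡ (sum-homo (f ∘ suc)))

  prod-homo : ∀ {n} (f : Fin n → S.Carrier) → φ (S.prod f) ≈ prod (φ ∘ f)
  prod-homo {zero}  f = 1#-homo
  prod-homo {suc n} f = trans (*-homo _ _) (*-congˡ (prod-homo (f ∘ suc)))

  sign-homo : ∀ k → φ ((S.- S.1#) S.^ k) ≈ (- 1#) ^ k
  sign-homo zero    = 1#-homo
  sign-homo (suc k) = trans (*-homo _ _)
    (*-cong (trans (-‿homo _) (-‿cong 1#-homo)) (sign-homo k))

  det-homo : ∀ {n} (A : Fin n → Fin n → S.Carrier) → φ (S.det A) ≈ det (λ i j → φ (A i j))
  det-homo {zero}  A = 1#-homo
  det-homo {suc n} A = trans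
    (sum-homo (λ i → (S.- S.1#) S.^ toℕ i S.* (A i zero S.* S.det (S.minor A i))))
    (sum-cong-≋ λ i → trans (*-homo _ _) (*-cong (sign-homo (toℕ i))
      (trans (*-homo _ _) (*-congˡ {φ (A i zero)} (det-homo (S.minor A i))))))

  ∑-homo : ∀ {e} {A : Set e} (xs : List A) f → φ (S.∑ xs f) ≈ ∑ xs (φ ∘ f)
  ∑-homo []       f = 0#-homo
  ∑-homo (x ∷ xs) f = trans (+-homo _ _) (+-congˡ (∑-homo xs f))

  ∑-*ˡ : ∀ {e} {A : Set e} (xs : List A) t f → t * ∑ xs f ≈ ∑ xs (λ a → t * f a)
  ∑-*ˡ []       t f = zeroʳ t
  ∑-*ˡ (x ∷ xs) t f = trans (distribˡ t (f x) (∑ xs f)) (+-congˡ (∑-*ˡ xs t f))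

  -- Has the shape of `indexSets`, so a sum over selected subsets is definitionally one over ℨ_α.
  select : ∀ {e p} {A : Set e} {B : A → Set p} → (∀ a → Dec (B a)) → List A → List (∃ B)
  select B? = List.mapMaybe λ a → Maybe.map (a ,_) (dec⇒maybe (B? a))

  ∑-select : ∀ {e p} {A : Set e} {B : A → Set p} (B? : ∀ a → Dec (B a)) (xs : List A) {f g} →
             (∀ a b → f a ≈ g (a , b)) → (∀ a → ¬ B a → f a ≈ 0#) →
             ∑ xs f ≈ ∑ (select B? xs) g
  ∑-select B? []       f≈g f≈0 = refl
  ∑-select B? (x ∷ xs) f≈g f≈0 with B? x
  ... | yes b = +-cong (f≈g x b) (∑-select B? xs f≈g f≈0)
  ... | no ¬b = trans (+-cong (f≈0 x ¬b) (∑-select B? xs f≈g f≈0)) (+-identityˡ _)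

  -- Nothing is divided: each numerator is replaced by its denominator times the quotient, and the
  -- denominators collect into `V`.
  clear-denominators : ∀ {n} (σ V t : S.Carrier) (num den : Fin n → S.Carrier)
    (q : Fin n → Carrier) →
    V S.≈ S.prod den → (∀ i → φ (den i) * q i ≈ φ (num i)) →
    φ (σ S.* S.prod num S.* t) ≈ φ σ * φ V * (φ t * prod q)
  clear-denominators σ V t num den q V≈ q≈ = begin
    φ (σ S.* S.prod num S.* t)
      ≈⟨ trans (*-homo _ _) (*-congʳ (*-homo _ _)) ⟩
    φ σ * φ (S.prod num) * φ t
      ≈⟨ *-congʳ (*-congˡ (trans (prod-homo num) (prod-cong λ i → sym (q≈ i)))) ⟩
    φ σ * prod (λ i → φ (den i) * q i) * φ t
      ≈⟨ *-congʳ (*-congˡ (prod-distrib-* (φ ∘ den) q)) ⟩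
    φ σ * (prod (φ ∘ den) * prod q) * φ t
      ≈⟨ *-congʳ (*-congˡ (*-congʳ (sym (trans (⟦⟧-cong V≈) (prod-homo den))))) ⟩
    φ σ * (φ V * prod q) * φ t
      ≈⟨ solve 4 (λ s v p t → s :* (v :* p) :* t := s :* v :* (t :* p)) refl
           (φ σ) (φ V) (prod q) (φ t) ⟩
    φ σ * φ V * (φ t * prod q) ∎

  -- The theorem with its ingredients made abstract. In the application `w` is a coordinate of the
  -- wedge of the block vectors, `c` a minor of the parameter matrix, `B` membership in ℨ_α, and `q`
  -- a Schur function.
  ∑-clear-denominators : ∀ {e p n} {A : Set e} {B : A → Set p} (B? : ∀ a → Dec (B a)) (xs : List A)
    {D : S.Carrier} (w c : A → S.Carrier) (σ V : S.Carrier)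
    (t : ∃ B → S.Carrier) (num : ∃ B → Fin n → S.Carrier) (den : Fin n → S.Carrier)
    (q : ∃ B → Fin n → Carrier) →
    D S.≈ S.∑ xs (λ a → w a S.* c a) →
    V S.≈ S.prod den →
    (∀ z i → φ (den i) * q z i ≈ φ (num z i)) →
    (∀ z → w (proj₁ z) S.≈ σ S.* S.prod (num z)) →
    (∀ z → c (proj₁ z) S.≈ t z) →
    (∀ a → ¬ B a → w a S.≈ S.0#) →
    φ D ≈ φ σ * φ V * ∑ (select B? xs) (λ z → φ (t z) * prod (q z))
  ∑-clear-denominators B? xs {D} w c σ V t num den q D≈ V≈ q≈ w≈ c≈ w≈0 = begin
    φ D
      ≈⟨ trans (⟦⟧-cong D≈) (∑-homo xs (λ a → w a S.* c a)) ⟩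
    ∑ xs (λ a → φ (w a S.* c a))
      ≈⟨ ∑-select B? xs
           (λ a b → trans (⟦⟧-cong (S.*-cong (w≈ (a , b)) (c≈ (a , b))))
             (clear-denominators σ V (t (a , b)) (num (a , b)) den (q (a , b)) V≈ (q≈ (a , b))))
           (λ a ¬b → trans (⟦⟧-cong (S.trans (S.*-congʳ (w≈0 a ¬b)) (S.zeroˡ _))) 0#-homo) ⟩
    ∑ (select B? xs) (λ z → φ σ * φ V * (φ (t z) * prod (q z)))
      ≈⟨ ∑-*ˡ (select B? xs) (φ σ * φ V) (λ z → φ (t z) * prod (q z)) ⟨
    φ σ * φ V * ∑ (select B? xs) (λ z → φ (t z) * prod (q z)) ∎

const-homomorphism : ∀ {c ℓ} (R : CommutativeRing c ℓ) N →
                     IsHomomorphism R (Polynomials.polynomialRing R N) (Polynomials.const R N)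
const-homomorphism R N = record
  { isSemiringHomomorphism = record
    { isNearSemiringHomomorphism = record
      { +-isMonoidHomomorphism = record
        { isMagmaHomomorphism = record
          { isRelHomomorphism = record { cong = λ a≈b m → +-congʳ (*-congʳ a≈b) }
          ; homo = λ a b m → trans (+-congʳ (distribʳ _ a b)) (+-assoc _ _ _)
          }
        ; ε-homo = λ m → trans (+-identityʳ _) (zeroˡ _)
        }
      ; *-homo = λ a b m → reflexive (≡.cong (λ e → a * b * δ e m + 0#) (≡.sym (·-identityˡ 𝟏)))
      }
    ; 1#-homo = λ m → refl
    }
  ; -‿homo = λ a m → refl
  }
  where
  open CommutativeRing R
  open Polynomials R N using (δ; 𝟏; ·-identityˡ)

embed-homomorphism : ∀ {c ℓ} (R : CommutativeRing c ℓ) →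
                     IsHomomorphism R (Fractions.fractionRing R) (Fractions.embed R)
embed-homomorphism R = record
  { isSemiringHomomorphism = record
    { isNearSemiringHomomorphism = record
      { +-isMonoidHomomorphism = record
        { isMagmaHomomorphism = record
          { isRelHomomorphism = record { cong = *-congʳ }
          ; homo = λ a b → trans (*-congˡ (*-identityˡ 1#))
              (*-congʳ (sym (+-cong (*-identityʳ a) (*-identityʳ b))))
          }
        ; ε-homo = refl
        }
      ; *-homo = λ a b → *-congˡ (*-identityˡ 1#)
      }
    ; 1#-homo = refl
    }
  ; -‿homo = λ a → refl
  }
  where open CommutativeRing R

embed-den-* : ∀ {c ℓ} (R : CommutativeRing c ℓ) (p : Fractions.Fraction R) →
  let open Fractions R; open Fraction p in (embed den *ᶠ p) ≈ᶠ embed num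
embed-den-* R p = trans (*-identityʳ _) (trans (*-comm _ _) (*-congˡ (sym (*-identityˡ _))))
  where open CommutativeRing R

-- The wedge expansion of the model matrix.

-- The two reversals cancel, and the row index restores what the standard partition subtracts. The
-- subtraction is not truncated, because the i-th element is at least i.
gapPartition-exponent : ∀ {m d} (p : Subset m) (eq : ∣ p ∣ ≡ d) (i : Fin d) →
  toℕ i Nat.+ Partition.parts (≡.subst Partition eq (gapPartition p)) (Fin.opposite i) ≡
  toℕ (Subsets.elements p (Fin.cast (≡.sym eq) i))
gapPartition-exponent p ≡.refl i = begin
  toℕ i Nat.+
    (toℕ (elements p (Fin.opposite (Fin.opposite i))) Nat.∸ toℕ (Fin.opposite (Fin.opposite i)))
    ≡⟨ ≡.cong (λ k → toℕ i Nat.+ (toℕ (elements p k) Nat.∸ toℕ k)) (Finₚ.opposite-involutive i) ⟩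
  toℕ i Nat.+ (toℕ (elements p i) Nat.∸ toℕ i)
    ≡⟨ ℕₚ.m+[n∸m]≡n (elements-≥ p i) ⟩
  toℕ (elements p i)
    ≡⟨ ≡.cong (toℕ ∘ elements p) (Finₚ.cast-is-id ≡.refl i) ⟨
  toℕ (elements p (Fin.cast ≡.refl i)) ∎
  where
  open ≡.≡-Reasoning
  open Subsets

module WordMatrix {a b c d} (R : CommutativeRing a b) (S : CommutativeRing c d)
  {κ : CommutativeRing.Carrier R → CommutativeRing.Carrier S} (κ-hom : IsHomomorphism R S κ)
  {N n ν : ℕ} (x : Fin N → CommutativeRing.Carrier S)
  (P : Model.ParameterTensor R N n ν) (v : Vec (Fin n) N) where

  open Model R using (flatten; submatrix)
  open CommutativeRing S hiding (zero)
  open import Algebra.Properties.Semiring.Exp semiring using (_^_)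
  open import Algebra.Properties.Semiring.Sum semiring using (sum; sum-cong-≋)
  open import Algebra.Properties.CommutativeMonoid.Sum *-commutativeMonoid
    using () renaming (sum to prod; sum-cong-≋ to prod-cong)
  open import Relation.Binary.Reasoning.Setoid setoid
  open Determinants S using (det; det-cong)
  open ListSum +-commutativeMonoid using (∑)
  open Exterior S
  open Blocks S
  open Products S using (ε^inv≈wordSign)
  open Subsets

  powers : Fin N → Fin ν → Carrier
  powers l k = x l ^ toℕ k

  parameters : Fin (n Nat.* ν) → Fin N → Carrier
  parameters q i = κ (flatten P i q)

  letterColumn : Fin N → Fin (n Nat.* ν) → Carrier
  letterColumn l = block (Vec.lookup v l) (powers l)

  matrix : Fin N → Fin N → Carrier
  matrix i l = sum λ k → κ (P i (Vec.lookup v l) k) * x l ^ toℕ k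

  matrix-factors : ∀ i l → matrix i l ≈ apply parameters (letterColumn l) i
  matrix-factors i l = sym (begin
    sum (λ q → block s (powers l) q * κ (flatten P i q))
      ≈⟨ sum-block s (powers l) (λ q → κ (flatten P i q)) ⟩
    sum (λ k → powers l k * κ (flatten P i (Fin.combine s k)))
      ≈⟨ sum-cong-≋ (λ k → trans
           (*-congˡ {powers l k} (reflexive (≡.cong (κ ∘ uncurry (P i)) (Finₚ.remQuot-combine s k))))
           (*-comm (powers l k) (κ (P i s k)))) ⟩
    sum (λ k → κ (P i s k) * powers l k) ∎)
    where
    s : Fin n
    s = Vec.lookup v l

  det-matrix-expansion : det matrix ≈
    ∑ (allSubsets (n Nat.* ν)) λ y → wedges letterColumn y * wedges (parameters ∘ elements y) ⊤
  det-matrix-expansion = trans (det-cong matrix-factors) (cauchy-binet parameters letterColumn)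

  parameter-minor : ∀ (z : IndexSet ν (abelianVector v)) →
    wedges (parameters ∘ elements (proj₁ z)) ⊤ ≈ κ (Determinants.det R (submatrix P v z))
  parameter-minor z = begin
    wedges (parameters ∘ elements (proj₁ z)) ⊤
      -- The columns are indexed by the size of the subset, which equals N only propositionally.
      ≈⟨ wedges-cast (size-indexSet v z) (parameters ∘ elements (proj₁ z)) ⊤ ⟩
    wedges (parameters ∘ elements (proj₁ z) ∘ Fin.cast (size-indexSet v z)) ⊤
      ≈⟨ wedges-⊤ (parameters ∘ elements (proj₁ z) ∘ Fin.cast (size-indexSet v z)) ⟩
    det (λ i l → κ (submatrix P v z i l))
      ≈⟨ Homomorphism.det-homo R S κ-hom (submatrix P v z) ⟨
    κ (Determinants.det R (submatrix P v z)) ∎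

  schurNumerator : IndexSet ν (abelianVector v) → Fin n → Carrier
  schurNumerator z i = det λ a j →
    x (elements (positions v i) j) ^
      (toℕ a Nat.+ Partition.parts (standardPartitions v z i) (Fin.opposite a))

  -- By `wedges-det` the coordinate is a generalised Vandermonde determinant whose exponents are the
  -- elements of the fibre in increasing order.
  letterWedges-schurNumerator : ∀ z i →
    letterWedges v powers i (fibre {n} (proj₁ z) i) ≈ schurNumerator z i
  letterWedges-schurNumerator (z , fibres) i = trans
    (wedges-det (powers ∘ elements (positions v i)) (fibre {n} z i) (≡.sym (fibres i)))
    (det-cong λ a j → reflexive (≡.cong (x (elements (positions v i) j) ^_)
      (≡.sym (gapPartition-exponent (fibre {n} z i) (fibres i) a))))

  wedges-letterColumn : ∀ y →
    wedges letterColumn y ≈ ε ^ inv v * tensor (letterWedges v powers) y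
  wedges-letterColumn y = trans (wedges-blocks v powers y) (*-congʳ (sym (ε^inv≈wordSign v)))

  wedges-balanced : ∀ z → wedges letterColumn (proj₁ z) ≈ ε ^ inv v * prod (schurNumerator z)
  wedges-balanced z = trans (wedges-letterColumn (proj₁ z))
    (*-congˡ (prod-cong (letterWedges-schurNumerator z)))

  -- Decidability provides a letter whose fibre has the wrong size, and homogeneity annihilates its
  -- tensor factor. This also disposes of subsets of the wrong total size.
  wedges-unbalanced : ∀ y → ¬ (∀ i → ∣ fibre {n} y i ∣ ≡ abelianVector v i) →
                      wedges letterColumn y ≈ 0#
  wedges-unbalanced y ¬fibres
    with Finₚ.¬∀⟶∃¬ n _ (λ i → ∣ fibre {n} y i ∣ ℕₚ.≟ abelianVector v i) ¬fibres
  ... | i , ne = trans (wedges-letterColumn y) (trans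
    (*-congˡ (prod-zero (λ i → letterWedges v powers i (fibre {n} y i)) i
      (wedges-homogeneous (powers ∘ elements (positions v i)) (fibre {n} y i) ne)))
    (zeroʳ _))
    where
    prod-zero : ∀ {k} (f : Fin k → Carrier) i → f i ≈ 0# → prod f ≈ 0#
    prod-zero f zero    fi≈0 = trans (*-congʳ fi≈0) (zeroˡ _)
    prod-zero f (suc i) fi≈0 = trans (*-congˡ (prod-zero (f ∘ suc) i fi≈0)) (zeroʳ _)

-- The let-bound abbreviations stand in for open Model R: a module application makes new
-- copies of all names, and matching two sets of copies at R = ℝ unfolds the Cauchy sequences.
det-modelMatrix : ∀ {c ℓ} (R : CommutativeRing c ℓ) {N n ν}
  (P : Model.ParameterTensor R N n ν) (v : Vec (Fin n) N) →
  let infix 4 _≈ᶠ_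
      infixl 7 _*ᶠ_
      _≈ᶠ_         = Model._≈ᶠ_ R {N}
      _*ᶠ_         = Model._*ᶠ_ R {N}
      embed        = Model.embed R {N}
      const        = Model.const R {N}
      det          = Model.det R {N}
      detᵖ         = Model.detᵖ R {N} {N}
      σ            = Model.σ R {N} {n}
      𝒱            = Model.𝒱 R {N} {n}
      modelMatrix  = Model.modelMatrix R {N} {n} {ν}
      submatrix    = Model.submatrix R {N} {n} {ν}
      partialSchur = Model.partialSchur R {N} {n}
      sumOver      = Model.sumOver R {N} {A = IndexSet ν (abelianVector v)}
  in
  embed (detᵖ (modelMatrix v P)) ≈ᶠ
    embed (σ v) *ᶠ embed (𝒱 v) *ᶠ
      sumOver (indexSets ν (abelianVector v)) (λ z →
        embed (const (det (submatrix P v z))) *ᶠ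
          partialSchur (Ω v) (standardPartitions v z))
det-modelMatrix R {N} {n} {ν} P v = ∑-clear-denominators
  (λ y → Finₚ.all? λ i → ∣ fibre {n} y i ∣ ℕₚ.≟ abelianVector v i)
  (allSubsets (n Nat.* ν))
  {detᵖ (modelMatrix v P)}
  (wedges letterColumn)
  (λ y → wedges (parameters ∘ elements y) ⊤)
  (σ v) (𝒱 v)
  (λ z → const (det (submatrix P v z)))
  schurNumerator
  (λ i → vandermonde (x ∘ elements (positions v i)))
  (λ z i → schur (positions v i) (standardPartitions v z i))
  det-matrix-expansion
  (vandermonde-divisor v x)
  (λ z i → embed-den-* (polynomials N) (schur (positions v i) (standardPartitions v z i)))
  wedges-balanced
  parameter-minor
  wedges-unbalanced
  where
  open Model R
  open Homomorphism (polynomials N) (rationalFunctions N) (embed-homomorphism (polynomials N))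
  open WordMatrix R (polynomials N) (const-homomorphism R N) x P v
  open Exterior (polynomials N) using (wedges)
  open Products (polynomials N) using (vandermonde-divisor)
  open Determinants (polynomials N) using (vandermonde)
  open Subsets

theorem2 : ∀ {c ℓ n} (W : CoxeterSystem c ℓ n) → Finite W → Irreducible W →
  let open CoxeterSystem W in
  (w∘ : Carrier) (N : ℕ) → IsLongest w∘ N →
  (ν : ℕ) → IsMaxOccurrences W w∘ N ν →
  (P : Model.ParameterTensor ℝ N n ν) (v : Vec (Fin n) N) → v Represents w∘ →
  let infix 4 _≈ᶠ_
      infixl 7 _*ᶠ_
      _≈ᶠ_         = Model._≈ᶠ_ ℝ {N}
      _*ᶠ_         = Model._*ᶠ_ ℝ {N}
      embed        = Model.embed ℝ {N}
      const        = Model.const ℝ {N}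
      det          = Model.det ℝ {N}
      detᵖ         = Model.detᵖ ℝ {N} {N}
      σ            = Model.σ ℝ {N} {n}
      𝒱            = Model.𝒱 ℝ {N} {n}
      modelMatrix  = Model.modelMatrix ℝ {N} {n} {ν}
      submatrix    = Model.submatrix ℝ {N} {n} {ν}
      partialSchur = Model.partialSchur ℝ {N} {n}
      sumOver      = Model.sumOver ℝ {N} {A = IndexSet ν (abelianVector v)}
  in
  embed (detᵖ (modelMatrix v P)) ≈ᶠ
    embed (σ v) *ᶠ embed (𝒱 v) *ᶠ
      sumOver (indexSets ν (abelianVector v)) (λ z →
        embed (const (det (submatrix P v z))) *ᶠ
          partialSchur (Ω v) (standardPartitions v z))
theorem2 W _ _ _ _ _ _ _ P v _ = det-modelMatrix ℝ P v
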